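{- Let $n\ge 1$ and let $L_n$ be the linear hexagonal chain with vertex set $\{p_0,\dots,p_n,q_0,\dots,q_n,u_0,\dots,u_{n-1},v_0,\dots,v_{n-1}\}$ and edges $p_iq_i$ $(0\le i\le n)$ and $p_iu_i,\ u_ip_{i+1},\ q_iv_i,\ v_iq_{i+1}$ $(0\le i\le n-1)$. Let $\alpha=3-2\sqrt2$ and let $r(a,b)$ denote the resistance distance in $L_n$. Then: (a) for $0\le i\le n$, $$r(p_i,q_i)=\frac{(1+\alpha^{2n-2i+1})(1+\alpha^{2i+1})}{\sqrt2\,(1-\alpha^{2n+2})};$$ (b) for $0\le j\le i\le n$, $$r(p_i,p_j)=i-j+\frac{1-\alpha^{i-j}}{4\sqrt2(1-\alpha^{2n+2})}\Big(2-\alpha^{i+j+1}+\alpha^{2j+1}+\alpha^{2n-2i+1}\big(1-\alpha^{i-j}-2\alpha^{i+j+1}\big)\Big),$$ $$r(q_i,p_j)=i-j+\frac{1+\alpha^{i-j}}{4\sqrt2(1-\alpha^{2n+2})}\Big(2+\alpha^{i+j+1}+\alpha^{2j+1}+\alpha^{2n-2i+1}\big(1+\alpha^{i-j}+2\alpha^{i+j+1}\big)\Big);$$ (c) for $0\le i\le n-1$, $$r(u_i,v_i)=\frac{\sqrt2\,(1+\alpha^{2i+2})(1+\alpha^{2n-2i})}{1-\alpha^{2n+2}}.$$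
   Context: The linear hexagonal chain $L_n$ consists of $n$ hexagons (6-cycles) in a row; its $i$-th hexagon ($1\le i\le n$) is the cycle $p_{i-1},u_{i-1},p_i,q_i,v_{i-1},q_{i-1}$, so $L_n$ has $4n+2$ vertices and $5n+1$ edges. The resistance distance $r(a,b)$ between vertices $a,b$ of a connected graph is the effective resistance between $a$ and $b$ in the electrical network obtained by placing a unit resistor on each edge; equivalently $r(a,b)=\ell^+_{aa}+\ell^+_{bb}-2\ell^+_{ab}$, where $\ell^+$ are the entries of the Moore–Penrose pseudoinverse of the Laplacian matrix. -}

module Defs where

open import Data.Nat using (ℕ; zero; suc)
open import Data.Fin using (Fin; inject₁) renaming (suc to fsuc)
import Data.Fin as Fin
open import Data.Bool using (Bool; true; false; if_then_else_)
open import Data.Rational using (ℚ; 0ℚ; 1ℚ; _+_; _*_; _-_; -_; _÷_; ≢-nonZero)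
import Data.Rational.Properties as ℚP
open import Data.List using (List; []; _∷_; map; _++_; foldr; allFin)
open import Data.Product using (_×_; _,_)
open import Relation.Nullary using (yes; no; does)
open import Relation.Binary.PropositionalEquality using (_≡_)

data V (n : ℕ) : Set where
  p q : Fin (suc n) → V n
  u v : Fin n → V n

_==_ : ∀ {n} → V n → V n → Bool
p i == p j = does (i Fin.≟ j)
q i == q j = does (i Fin.≟ j)
u i == u j = does (i Fin.≟ j)
v i == v j = does (i Fin.≟ j)
_ == _ = false

edges : (n : ℕ) → List (V n × V n)
edges n =
  map (λ i → (p i , q i)) (allFin (suc n)) ++
  map (λ i → (p (inject₁ i) , u i)) (allFin n) ++
  map (λ i → (u i , p (fsuc i))) (allFin n) ++
  map (λ i → (q (inject₁ i) , v i)) (allFin n) ++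
  map (λ i → (v i , q (fsuc i))) (allFin n)

sumℚ : List ℚ → ℚ
sumℚ = foldr _+_ 0ℚ

laplacian : (n : ℕ) → (V n → ℚ) → V n → ℚ
laplacian n x w = sumℚ (map contrib (edges n))
  where
  contrib : V n × V n → ℚ
  contrib (a , b) =
    (if w == a then x a - x b else 0ℚ) + (if w == b then x b - x a else 0ℚ)

δ : ∀ {n} → V n → V n → ℚ
δ a w = if w == a then 1ℚ else 0ℚ

-- The field ℚ(√2): a + b√2 is represented by  a ⊹ b

record ℚ√2 : Set where
  constructor _⊹_
  field
    re im : ℚ

open ℚ√2 public

embed : ℚ → ℚ√2
embed a = a ⊹ 0ℚ

infixl 6 _⊕_ _⊖_
infixl 7 _⊗_ _⊘_

_⊕_ : ℚ√2 → ℚ√2 → ℚ√2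
(a ⊹ b) ⊕ (c ⊹ d) = (a + c) ⊹ (b + d)

⊖1 : ℚ√2 → ℚ√2
⊖1 (a ⊹ b) = (- a) ⊹ (- b)

_⊖_ : ℚ√2 → ℚ√2 → ℚ√2
x ⊖ y = x ⊕ ⊖1 y

_⊗_ : ℚ√2 → ℚ√2 → ℚ√2
(a ⊹ b) ⊗ (c ⊹ d) = (a * c + (1ℚ + 1ℚ) * (b * d)) ⊹ (a * d + b * c)

-- total division on ℚ (x / 0 := 0; only used with nonzero divisors)
divℚ : ℚ → ℚ → ℚ
divℚ x y with y ℚP.≟ 0ℚ
... | yes _ = 0ℚ
... | no y≢0 = _÷_ x y {{≢-nonZero y≢0}}

-- inverse in ℚ(√2): (a + b√2)⁻¹ = (a - b√2)/(a² - 2b²); 0⁻¹ := 0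
inv : ℚ√2 → ℚ√2
inv (a ⊹ b) = divℚ a N ⊹ divℚ (- b) N
  where N = a * a - (1ℚ + 1ℚ) * (b * b)

_⊘_ : ℚ√2 → ℚ√2 → ℚ√2
x ⊘ y = x ⊗ inv y

infixr 8 _^_
_^_ : ℚ√2 → ℕ → ℚ√2
x ^ zero = 1ℚ ⊹ 0ℚ
x ^ suc k = x ⊗ (x ^ k)

one √2 : ℚ√2
one = 1ℚ ⊹ 0ℚ
√2 = 0ℚ ⊹ 1ℚ

nat : ℕ → ℚ√2
nat zero = 0ℚ ⊹ 0ℚ
nat (suc k) = one ⊕ nat k

α : ℚ√2
α = embed (1ℚ + 1ℚ + 1ℚ) ⊖ (embed (1ℚ + 1ℚ) ⊗ √2)

-- Resistance distance (electrical definition): r(a,b) = x_a - x_b for a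
-- potential x with L x = e_a - e_b (current 1 injected at a, extracted
-- at b).  Since L_n is connected, such x exists and x_a - x_b does not
-- depend on the choice of x.  "r(a,b) = ρ" is stated as: some such
-- potential exists, and every such potential gives x_a - x_b = ρ.

IsPotential : (n : ℕ) → V n → V n → (V n → ℚ) → Set
IsPotential n a b x = ∀ w → laplacian n x w ≡ δ a w - δ b w

record ResistanceIs (n : ℕ) (a b : V n) (ρ : ℚ√2) : Set where
  field
    potential : V n → ℚ
    isPotential : IsPotential n a b potential
    unique : ∀ x → IsPotential n a b x → embed (x a - x b) ≡ ρ

module Submission where

-- Every resistance is read off an explicit potential. A potential x with L x = 0 is constant: along
-- the chain the currents entering a rung from the left cancel, x (p j) + x (q j) is constant, and
-- x (p j) - x (q j) and the difference of the two currents grow from x (p 0) - x (q 0) by positive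
-- factors, which the balance at the right end forces to vanish. Hence x a - x b does not depend on the
-- potential chosen.
--
-- The reflection p ↔ q splits every source into a symmetric and an antisymmetric part. The source
-- δ (p (t + 1)) + δ (q (t + 1)) - δ (p t) - δ (q t) is solved by a step of height 2 on both rails. The source
-- δ (p K) - δ (q K) is solved by x (p j) = - x (q j) = d j with every u, v at the mean of its neighbours;
-- then (L x)(p j) = 3 d j - (d (j - 1) + d (j + 1)) / 2, so d is a combination of α ^ j and α ^ (- j)
-- on either side of K. These computations take place in ℚ(√2); the imaginary part of such a solution
-- has zero Laplacian, hence is constant, and its real part is a rational potential with the same
-- differences. The resistances of the theorem are linear combinations of these potentials and, for
-- u i and v i, of a dipole sending current from u i to v i.

module SqrtTwo where

  open import Defs
  open import Data.Nat using (ℕ; zero; suc)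
  import Data.Nat as ℕ
  open import Data.Rational using (ℚ; 0ℚ; 1ℚ; _+_; _*_; _-_; -_; 1/_; _÷_; ≢-nonZero)
  import Data.Rational.Properties as ℚP
  open import Data.List using ([]; _∷_)
  open import Data.Product using (_,_)
  open import Data.Empty using (⊥-elim)
  open import Algebra.Bundles using (CommutativeRing)
  open import Algebra.Structures using (IsCommutativeRing)
  open import Algebra.Consequences.Propositional using (comm∧idˡ⇒idʳ; comm∧invˡ⇒invʳ; comm∧distrʳ⇒distrˡ)
  import Tactic.RingSolver.Core.AlmostCommutativeRing as ACR
  open import Tactic.RingSolver using (solve)
  open import Relation.Nullary using (yes; no; Dec)
  open import Relation.Nullary.Decidable using (dec⇒maybe)
  open import Relation.Binary.PropositionalEquality
  open import Level using (0ℓ)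

  ℚ-ring : ACR.AlmostCommutativeRing 0ℓ 0ℓ
  ℚ-ring = ACR.fromCommutativeRing ℚP.+-*-commutativeRing (λ x → dec⇒maybe (0ℚ ℚP.≟ x))

  0ℚ√2 : ℚ√2
  0ℚ√2 = 0ℚ ⊹ 0ℚ

  _≟ℚ√2_ : (x y : ℚ√2) → Dec (x ≡ y)
  (a ⊹ b) ≟ℚ√2 (c ⊹ d) with a ℚP.≟ c | b ℚP.≟ d
  ... | yes refl | yes refl = yes refl
  ... | no a≢c | _ = no λ { refl → a≢c refl }
  ... | _ | no b≢d = no λ { refl → b≢d refl }

  ⊕-assoc : ∀ x y z → (x ⊕ y) ⊕ z ≡ x ⊕ (y ⊕ z)
  ⊕-assoc (a ⊹ b) (c ⊹ d) (e ⊹ f) = cong₂ _⊹_ (ℚP.+-assoc a c e) (ℚP.+-assoc b d f)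

  ⊕-comm : ∀ x y → x ⊕ y ≡ y ⊕ x
  ⊕-comm (a ⊹ b) (c ⊹ d) = cong₂ _⊹_ (ℚP.+-comm a c) (ℚP.+-comm b d)

  ⊕-identityˡ : ∀ x → 0ℚ√2 ⊕ x ≡ x
  ⊕-identityˡ (a ⊹ b) = cong₂ _⊹_ (ℚP.+-identityˡ a) (ℚP.+-identityˡ b)

  ⊕-inverseˡ : ∀ x → ⊖1 x ⊕ x ≡ 0ℚ√2
  ⊕-inverseˡ (a ⊹ b) = cong₂ _⊹_ (ℚP.+-inverseˡ a) (ℚP.+-inverseˡ b)

  ⊗-assoc : ∀ x y z → (x ⊗ y) ⊗ z ≡ x ⊗ (y ⊗ z)
  ⊗-assoc (a ⊹ b) (c ⊹ d) (e ⊹ f) = cong₂ _⊹_ re-assoc im-assoc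
    where
    re-assoc : (a * c + (1ℚ + 1ℚ) * (b * d)) * e + (1ℚ + 1ℚ) * ((a * d + b * c) * f)
             ≡ a * (c * e + (1ℚ + 1ℚ) * (d * f)) + (1ℚ + 1ℚ) * (b * (c * f + d * e))
    re-assoc = solve (a ∷ b ∷ c ∷ d ∷ e ∷ f ∷ []) ℚ-ring
    im-assoc : (a * c + (1ℚ + 1ℚ) * (b * d)) * f + (a * d + b * c) * e
             ≡ a * (c * f + d * e) + b * (c * e + (1ℚ + 1ℚ) * (d * f))
    im-assoc = solve (a ∷ b ∷ c ∷ d ∷ e ∷ f ∷ []) ℚ-ring

  ⊗-comm : ∀ x y → x ⊗ y ≡ y ⊗ x
  ⊗-comm (a ⊹ b) (c ⊹ d) = cong₂ _⊹_ re-comm im-comm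
    where
    re-comm : a * c + (1ℚ + 1ℚ) * (b * d) ≡ c * a + (1ℚ + 1ℚ) * (d * b)
    re-comm = solve (a ∷ b ∷ c ∷ d ∷ []) ℚ-ring
    im-comm : a * d + b * c ≡ c * b + d * a
    im-comm = solve (a ∷ b ∷ c ∷ d ∷ []) ℚ-ring

  ⊗-identityˡ : ∀ x → one ⊗ x ≡ x
  ⊗-identityˡ (a ⊹ b) = cong₂ _⊹_ re-identity im-identity
    where
    re-identity : 1ℚ * a + (1ℚ + 1ℚ) * (0ℚ * b) ≡ a
    re-identity = solve (a ∷ b ∷ []) ℚ-ring
    im-identity : 1ℚ * b + 0ℚ * a ≡ b
    im-identity = solve (a ∷ b ∷ []) ℚ-ring

  ⊗-distribʳ-⊕ : ∀ x y z → (y ⊕ z) ⊗ x ≡ (y ⊗ x) ⊕ (z ⊗ x)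
  ⊗-distribʳ-⊕ (a ⊹ b) (c ⊹ d) (e ⊹ f) = cong₂ _⊹_ re-distrib im-distrib
    where
    re-distrib : (c + e) * a + (1ℚ + 1ℚ) * ((d + f) * b)
               ≡ (c * a + (1ℚ + 1ℚ) * (d * b)) + (e * a + (1ℚ + 1ℚ) * (f * b))
    re-distrib = solve (a ∷ b ∷ c ∷ d ∷ e ∷ f ∷ []) ℚ-ring
    im-distrib : (c + e) * b + (d + f) * a ≡ (c * b + d * a) + (e * b + f * a)
    im-distrib = solve (a ∷ b ∷ c ∷ d ∷ e ∷ f ∷ []) ℚ-ring

  ℚ√2-commutativeRing : CommutativeRing 0ℓ 0ℓ
  ℚ√2-commutativeRing = record
    { Carrier = ℚ√2 ; _≈_ = _≡_ ; _+_ = _⊕_ ; _*_ = _⊗_ ; -_ = ⊖1 ; 0# = 0ℚ√2 ; 1# = one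
    ; isCommutativeRing = isCommutativeRing }
    where
    isCommutativeRing : IsCommutativeRing _≡_ _⊕_ _⊗_ ⊖1 0ℚ√2 one
    isCommutativeRing = record
      { isRing = record
        { +-isAbelianGroup = record
          { isGroup = record
            { isMonoid = record
              { isSemigroup = record
                { isMagma = record { isEquivalence = isEquivalence ; ∙-cong = cong₂ _⊕_ }
                ; assoc = ⊕-assoc }
              ; identity = ⊕-identityˡ , comm∧idˡ⇒idʳ ⊕-comm ⊕-identityˡ }
            ; inverse = ⊕-inverseˡ , comm∧invˡ⇒invʳ ⊕-comm ⊕-inverseˡ
            ; ⁻¹-cong = cong ⊖1 }
          ; comm = ⊕-comm }
        ; *-cong = cong₂ _⊗_
        ; *-assoc = ⊗-assoc
        ; *-identity = ⊗-identityˡ , comm∧idˡ⇒idʳ ⊗-comm ⊗-identityˡ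
        ; distrib = comm∧distrʳ⇒distrˡ ⊗-comm ⊗-distribʳ-⊕ , ⊗-distribʳ-⊕ }
      ; *-comm = ⊗-comm }

  ℚ√2-ring : ACR.AlmostCommutativeRing 0ℓ 0ℓ
  ℚ√2-ring = ACR.fromCommutativeRing ℚ√2-commutativeRing (λ x → dec⇒maybe (0ℚ√2 ≟ℚ√2 x))

  ^-+ : ∀ x a b → x ^ (a ℕ.+ b) ≡ x ^ a ⊗ x ^ b
  ^-+ x zero b = sym (⊗-identityˡ _)
  ^-+ x (suc a) b = trans (cong (x ⊗_) (^-+ x a b)) (sym (⊗-assoc x _ _))

  norm : ℚ√2 → ℚ
  norm (a ⊹ b) = a * a - (1ℚ + 1ℚ) * (b * b)

  norm-⊗ : ∀ x y → norm (x ⊗ y) ≡ norm x * norm y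
  norm-⊗ (a ⊹ b) (c ⊹ d) = brahmagupta
    where
    brahmagupta : (a * c + (1ℚ + 1ℚ) * (b * d)) * (a * c + (1ℚ + 1ℚ) * (b * d))
                    - (1ℚ + 1ℚ) * ((a * d + b * c) * (a * d + b * c))
                ≡ (a * a - (1ℚ + 1ℚ) * (b * b)) * (c * c - (1ℚ + 1ℚ) * (d * d))
    brahmagupta = solve (a ∷ b ∷ c ∷ d ∷ []) ℚ-ring

  *-≢0 : ∀ {x y} → x ≢ 0ℚ → y ≢ 0ℚ → x * y ≢ 0ℚ
  *-≢0 {x} {y} x≢0 y≢0 xy≡0 = x≢0 (begin
    x               ≡⟨ sym (ℚP.*-identityʳ x) ⟩
    x * 1ℚ          ≡⟨ cong (x *_) (sym (ℚP.*-inverseʳ y)) ⟩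
    x * (y * 1/ y)  ≡⟨ sym (ℚP.*-assoc x y (1/ y)) ⟩
    (x * y) * 1/ y  ≡⟨ cong (_* 1/ y) xy≡0 ⟩
    0ℚ * 1/ y       ≡⟨ ℚP.*-zeroˡ (1/ y) ⟩
    0ℚ              ∎)
    where
    open ≡-Reasoning
    instance _ = ≢-nonZero y≢0

  divℚ-≢0 : ∀ x y (y≢0 : y ≢ 0ℚ) → divℚ x y ≡ _÷_ x y {{≢-nonZero y≢0}}
  divℚ-≢0 x y y≢0 with y ℚP.≟ 0ℚ
  ... | yes y≡0 = ⊥-elim (y≢0 y≡0)
  ... | no _ = refl

  ⊗-inverseʳ : ∀ z → norm z ≢ 0ℚ → z ⊗ inv z ≡ one
  ⊗-inverseʳ (a ⊹ b) N≢0 = cong₂ _⊹_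
    (trans (cong₂ (λ s t → a * s + (1ℚ + 1ℚ) * (b * t)) (divℚ-≢0 a N N≢0) (divℚ-≢0 (- b) N N≢0))
           (trans (re-conj a b (1/ N)) (ℚP.*-inverseʳ N)))
    (trans (cong₂ (λ s t → a * t + b * s) (divℚ-≢0 a N N≢0) (divℚ-≢0 (- b) N N≢0)) (im-conj a b (1/ N)))
    where
    N = norm (a ⊹ b)
    instance _ = ≢-nonZero N≢0
    re-conj : ∀ a b r → a * (a * r) + (1ℚ + 1ℚ) * (b * (- b * r)) ≡ (a * a - (1ℚ + 1ℚ) * (b * b)) * r
    re-conj a b r = solve (a ∷ b ∷ r ∷ []) ℚ-ring
    im-conj : ∀ a b r → a * (- b * r) + b * (a * r) ≡ 0ℚ
    im-conj a b r = solve (a ∷ b ∷ r ∷ []) ℚ-ring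

  inv-unique : ∀ z w → norm z ≢ 0ℚ → z ⊗ w ≡ one → inv z ≡ w
  inv-unique z w N≢0 zw≡1 = begin
    inv z              ≡⟨ sym (trans (⊗-comm (inv z) one) (⊗-identityˡ (inv z))) ⟩
    inv z ⊗ one        ≡⟨ cong (inv z ⊗_) (sym zw≡1) ⟩
    inv z ⊗ (z ⊗ w)    ≡⟨ reassociate (inv z) z w ⟩
    (z ⊗ inv z) ⊗ w    ≡⟨ cong (_⊗ w) (⊗-inverseʳ z N≢0) ⟩
    one ⊗ w            ≡⟨ ⊗-identityˡ w ⟩
    w                  ∎
    where
    open ≡-Reasoning
    reassociate : ∀ a b c → a ⊗ (b ⊗ c) ≡ (b ⊗ a) ⊗ c
    reassociate a b c = solve (a ∷ b ∷ c ∷ []) ℚ√2-ring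

  inv-⊗ : ∀ x y → norm x ≢ 0ℚ → norm y ≢ 0ℚ → inv (x ⊗ y) ≡ inv x ⊗ inv y
  inv-⊗ x y Nx≢0 Ny≢0 = inv-unique (x ⊗ y) (inv x ⊗ inv y)
    (λ Nxy≡0 → *-≢0 Nx≢0 Ny≢0 (trans (sym (norm-⊗ x y)) Nxy≡0))
    (begin
      (x ⊗ y) ⊗ (inv x ⊗ inv y)      ≡⟨ interchange x y (inv x) (inv y) ⟩
      (x ⊗ inv x) ⊗ (y ⊗ inv y)      ≡⟨ cong₂ _⊗_ (⊗-inverseʳ x Nx≢0) (⊗-inverseʳ y Ny≢0) ⟩
      one ⊗ one                      ≡⟨⟩
      one                            ∎)
    where
    open ≡-Reasoning
    interchange : ∀ a b c d → (a ⊗ b) ⊗ (c ⊗ d) ≡ (a ⊗ c) ⊗ (b ⊗ d)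
    interchange a b c d = solve (a ∷ b ∷ c ∷ d ∷ []) ℚ√2-ring

module Alpha where

  open import Defs
  open SqrtTwo
  open import Data.Nat using (ℕ; zero; suc)
  open import Data.Rational using (ℚ; 0ℚ; 1ℚ; _+_; _*_; _-_; -_; _≤_; _<_)
  import Data.Rational.Properties as ℚP
  open import Data.List using ([]; _∷_)
  open import Data.Product using (_×_; _,_; proj₁; proj₂)
  open import Tactic.RingSolver using (solve)
  open import Relation.Nullary.Decidable using (toWitness)
  open import Relation.Binary.PropositionalEquality

  mutual
    pellX pellY : ℕ → ℚ
    pellX zero = 1ℚ
    pellX (suc m) = pellX m + pellX m + pellX m + pellY m + pellY m + pellY m + pellY m
    pellY zero = 0ℚ
    pellY (suc m) = pellX m + pellX m + pellY m + pellY m + pellY m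

  α^≡pell : ∀ m → α ^ m ≡ pellX m ⊹ (- pellY m)
  α^≡pell zero = refl
  α^≡pell (suc m) = trans (cong (α ⊗_) (α^≡pell m)) (cong₂ _⊹_ (re-step (pellX m) (pellY m)) (im-step (pellX m) (pellY m)))
    where
    re-step : ∀ a b → re α * a + (1ℚ + 1ℚ) * (im α * (- b)) ≡ a + a + a + b + b + b + b
    re-step a b = solve (a ∷ b ∷ []) ℚ-ring
    im-step : ∀ a b → re α * (- b) + im α * a ≡ - (a + a + b + b + b)
    im-step a b = solve (a ∷ b ∷ []) ℚ-ring

  pell-equation : ∀ m → pellX m * pellX m - (1ℚ + 1ℚ) * (pellY m * pellY m) ≡ 1ℚ
  pell-equation zero = refl
  pell-equation (suc m) = trans (step (pellX m) (pellY m)) (pell-equation m)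
    where
    step : ∀ a b → (a + a + a + b + b + b + b) * (a + a + a + b + b + b + b)
                     - (1ℚ + 1ℚ) * ((a + a + b + b + b) * (a + a + b + b + b))
                 ≡ a * a - (1ℚ + 1ℚ) * (b * b)
    step a b = solve (a ∷ b ∷ []) ℚ-ring

  pell-bounds : ∀ m → 1ℚ ≤ pellX m × 0ℚ ≤ pellY m
  pell-bounds zero = ℚP.≤-refl , ℚP.≤-refl
  pell-bounds (suc m) with pell-bounds m
  ... | 1≤a , 0≤b =
    ℚP.≤-trans (toWitness {a? = 1ℚ ℚP.≤? 1ℚ + 1ℚ + 1ℚ + 0ℚ + 0ℚ + 0ℚ + 0ℚ} _)
      (+-mono⁷ 1≤a 1≤a 1≤a 0≤b 0≤b 0≤b 0≤b) ,
    ℚP.≤-trans (toWitness {a? = 0ℚ ℚP.≤? 1ℚ + 1ℚ + 0ℚ + 0ℚ + 0ℚ} _)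
      (ℚP.+-mono-≤ (ℚP.+-mono-≤ (ℚP.+-mono-≤ (ℚP.+-mono-≤ 1≤a 1≤a) 0≤b) 0≤b) 0≤b)
    where
    +-mono⁷ : ∀ {a b c d e f g a' b' c' d' e' f' g'} →
      a ≤ a' → b ≤ b' → c ≤ c' → d ≤ d' → e ≤ e' → f ≤ f' → g ≤ g' →
      a + b + c + d + e + f + g ≤ a' + b' + c' + d' + e' + f' + g'
    +-mono⁷ h₁ h₂ h₃ h₄ h₅ h₆ h₇ =
      ℚP.+-mono-≤ (ℚP.+-mono-≤ (ℚP.+-mono-≤ (ℚP.+-mono-≤ (ℚP.+-mono-≤ (ℚP.+-mono-≤ h₁ h₂) h₃) h₄) h₅) h₆) h₇

  -- With α ^ (m + 1) = A - B √2 and A² - 2B² = 1, the norm of 1 - α ^ (m + 1) is 2 - 2A, and A ≥ 3.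
  norm[1-α^suc]≢0 : ∀ m → norm (one ⊖ α ^ suc m) ≢ 0ℚ
  norm[1-α^suc]≢0 m N≡0 = ℚP.<-irrefl 2≡A+A 2<A+A
    where
    A = pellX (suc m)
    B = pellY (suc m)
    3≤A : 1ℚ + 1ℚ + 1ℚ ≤ A
    3≤A = ℚP.≤-trans (toWitness {a? = 1ℚ + 1ℚ + 1ℚ ℚP.≤? 1ℚ + 1ℚ + 1ℚ + 0ℚ + 0ℚ + 0ℚ + 0ℚ} _)
            (ℚP.+-mono-≤ (ℚP.+-mono-≤ (ℚP.+-mono-≤ (ℚP.+-mono-≤ (ℚP.+-mono-≤ (ℚP.+-mono-≤ 1≤a 1≤a) 1≤a) 0≤b) 0≤b) 0≤b) 0≤b)
      where
      1≤a = proj₁ (pell-bounds m)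
      0≤b = proj₂ (pell-bounds m)
    2<A+A : 1ℚ + 1ℚ < A + A
    2<A+A = ℚP.<-≤-trans (toWitness {a? = 1ℚ + 1ℚ ℚP.<? (1ℚ + 1ℚ + 1ℚ) + (1ℚ + 1ℚ + 1ℚ)} _) (ℚP.+-mono-≤ 3≤A 3≤A)
    expand : ∀ a b → (1ℚ + - a) * (1ℚ + - a) - (1ℚ + 1ℚ) * ((0ℚ + - (- b)) * (0ℚ + - (- b)))
                   ≡ ((1ℚ + 1ℚ) - (a + a)) + ((a * a - (1ℚ + 1ℚ) * (b * b)) - 1ℚ)
    expand a b = solve (a ∷ b ∷ []) ℚ-ring
    norm≡2-2A : norm (one ⊖ α ^ suc m) ≡ (1ℚ + 1ℚ) - (A + A)
    norm≡2-2A = trans (cong (λ z → norm (one ⊖ z)) (α^≡pell (suc m)))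
      (trans (expand A B) (trans (cong (λ z → ((1ℚ + 1ℚ) - (A + A)) + (z - 1ℚ)) (pell-equation (suc m))) (ℚP.+-identityʳ _)))
    x≡y-[y-x] : ∀ x y → x ≡ y - (y - x)
    x≡y-[y-x] x y = solve (x ∷ y ∷ []) ℚ-ring
    2≡A+A : 1ℚ + 1ℚ ≡ A + A
    2≡A+A = sym (trans (x≡y-[y-x] (A + A) (1ℚ + 1ℚ))
      (trans (cong (λ z → (1ℚ + 1ℚ) - z) (trans (sym norm≡2-2A) N≡0)) (ℚP.+-identityʳ _)))

module Laplacian where

  open import Defs
  open SqrtTwo using (ℚ-ring)
  open import Data.Nat using (ℕ; zero; suc; _<_; s≤s; _≡ᵇ_)
  open import Data.Fin using (Fin; toℕ; inject₁) renaming (zero to fz; suc to fs)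
  import Data.Fin as Fin
  import Data.Fin.Properties as FinP
  open import Data.Rational using (ℚ; 0ℚ; 1ℚ; _+_; _-_; _*_)
  import Data.Rational.Properties as ℚP
  open import Data.List using (List; []; _∷_; map; _++_; tabulate; allFin)
  import Data.List.Properties as ListP
  open import Data.Product using (_×_; _,_)
  open import Data.Bool using (Bool; true; false; if_then_else_)
  open import Relation.Nullary using (does)
  open import Function using (_∘_; id)
  open import Tactic.RingSolver using (solve)
  open import Relation.Binary.PropositionalEquality

  sumℚ-map-cong : ∀ {A : Set} {f g : A → ℚ} (l : List A) → (∀ a → f a ≡ g a) → sumℚ (map f l) ≡ sumℚ (map g l)
  sumℚ-map-cong [] f≗g = refl
  sumℚ-map-cong (a ∷ l) f≗g = cong₂ _+_ (f≗g a) (sumℚ-map-cong l f≗g)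

  sumℚ-++ : ∀ (xs ys : List ℚ) → sumℚ (xs ++ ys) ≡ sumℚ xs + sumℚ ys
  sumℚ-++ [] ys = sym (ℚP.+-identityˡ _)
  sumℚ-++ (x ∷ xs) ys = trans (cong (x +_) (sumℚ-++ xs ys)) (sym (ℚP.+-assoc x _ _))

  Σℚ : (m : ℕ) → (Fin m → ℚ) → ℚ
  Σℚ m F = sumℚ (tabulate F)

  contribution : ∀ {n} → (V n → ℚ) → V n → V n × V n → ℚ
  contribution x w (a , b) = (if w == a then x a - x b else 0ℚ) + (if w == b then x b - x a else 0ℚ)

  laplacian-unfold : ∀ n x w → laplacian n x w ≡ sumℚ (map (contribution x w) (edges n))
  laplacian-unfold n x w = sym (sumℚ-map-cong {f = contribution x w} (edges n) λ _ → refl)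

  laplacian-cong : ∀ n (x y : V n → ℚ) → (∀ w → x w ≡ y w) → ∀ w → laplacian n x w ≡ laplacian n y w
  laplacian-cong n x y x≗y w = trans (laplacian-unfold n x w) (trans (sumℚ-map-cong (edges n)
    (λ { (a , b) → cong₂ (λ s t → (if w == a then s - t else 0ℚ) + (if w == b then t - s else 0ℚ)) (x≗y a) (x≗y b) }))
    (sym (laplacian-unfold n y w)))

  module _ {n : ℕ} (a b : ℚ) (x y : V n → ℚ) (w : V n) where

    private
      z : V n → ℚ
      z t = a * x t + b * y t

      contribution-linear : ∀ (edge : V n × V n) →
        contribution z w edge ≡ a * contribution x w edge + b * contribution y w edge
      contribution-linear (s , t) = by-cases (w == s) (w == t)
        where
        by-cases : ∀ c₁ c₂ →
          (if c₁ then z s - z t else 0ℚ) + (if c₂ then z t - z s else 0ℚ) ≡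
          a * ((if c₁ then x s - x t else 0ℚ) + (if c₂ then x t - x s else 0ℚ)) +
          b * ((if c₁ then y s - y t else 0ℚ) + (if c₂ then y t - y s else 0ℚ))
        by-cases true true = both (x s) (x t) (y s) (y t)
          where
          both : ∀ xs xt ys yt → ((a * xs + b * ys) - (a * xt + b * yt)) + ((a * xt + b * yt) - (a * xs + b * ys))
                               ≡ a * ((xs - xt) + (xt - xs)) + b * ((ys - yt) + (yt - ys))
          both xs xt ys yt = solve (a ∷ b ∷ xs ∷ xt ∷ ys ∷ yt ∷ []) ℚ-ring
        by-cases true false = tail (x s) (x t) (y s) (y t)
          where
          tail : ∀ xs xt ys yt → ((a * xs + b * ys) - (a * xt + b * yt)) + 0ℚ ≡ a * ((xs - xt) + 0ℚ) + b * ((ys - yt) + 0ℚ)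
          tail xs xt ys yt = solve (a ∷ b ∷ xs ∷ xt ∷ ys ∷ yt ∷ []) ℚ-ring
        by-cases false true = head (x s) (x t) (y s) (y t)
          where
          head : ∀ xs xt ys yt → 0ℚ + ((a * xt + b * yt) - (a * xs + b * ys)) ≡ a * (0ℚ + (xt - xs)) + b * (0ℚ + (yt - ys))
          head xs xt ys yt = solve (a ∷ b ∷ xs ∷ xt ∷ ys ∷ yt ∷ []) ℚ-ring
        by-cases false false = solve (a ∷ b ∷ []) ℚ-ring

      sum-linear : ∀ (l : List (V n × V n)) →
        sumℚ (map (contribution z w) l) ≡ a * sumℚ (map (contribution x w) l) + b * sumℚ (map (contribution y w) l)
      sum-linear [] = solve (a ∷ b ∷ []) ℚ-ring
      sum-linear (edge ∷ l) = trans (cong₂ _+_ (contribution-linear edge) (sum-linear l)) (regroup _ _ _ _)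
        where
        regroup : ∀ c d S T → (a * c + b * d) + (a * S + b * T) ≡ a * (c + S) + b * (d + T)
        regroup c d S T = solve (a ∷ b ∷ c ∷ d ∷ S ∷ T ∷ []) ℚ-ring

    laplacian-linear : laplacian n (λ t → a * x t + b * y t) w ≡ a * laplacian n x w + b * laplacian n y w
    laplacian-linear = trans (laplacian-unfold n z w) (trans (sum-linear (edges n))
      (sym (cong₂ (λ s t → a * s + b * t) (laplacian-unfold n x w) (laplacian-unfold n y w))))

  laplacian-linear₃ : ∀ n (a b c : ℚ) (x y z : V n → ℚ) w →
    laplacian n (λ t → a * x t + (b * y t + c * z t)) w ≡ a * laplacian n x w + (b * laplacian n y w + c * laplacian n z w)
  laplacian-linear₃ n a b c x y z w =
    trans (laplacian-cong n _ _ (λ t → cong (a * x t +_) (sym (ℚP.*-identityˡ (b * y t + c * z t)))) w)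
    (trans (laplacian-linear a 1ℚ x (λ t → b * y t + c * z t) w)
      (cong (a * laplacian n x w +_) (trans (ℚP.*-identityˡ _) (laplacian-linear b c y z w))))

  laplacian-0 : ∀ n w → laplacian n (λ _ → 0ℚ) w ≡ 0ℚ
  laplacian-0 n w = trans (laplacian-unfold n (λ _ → 0ℚ) w) (sum-0 (edges n))
    where
    contribution-0 : ∀ c₁ c₂ → (if c₁ then 0ℚ - 0ℚ else 0ℚ) + (if c₂ then 0ℚ - 0ℚ else 0ℚ) ≡ 0ℚ
    contribution-0 true true = refl
    contribution-0 true false = refl
    contribution-0 false true = refl
    contribution-0 false false = refl
    sum-0 : ∀ l → sumℚ (map (contribution (λ _ → 0ℚ) w) l) ≡ 0ℚ
    sum-0 [] = refl
    sum-0 ((a , b) ∷ l) = cong₂ _+_ (contribution-0 (w == a) (w == b)) (sum-0 l)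

  laplacian-byEdgeClass : ∀ n (x : V n → ℚ) w → laplacian n x w ≡
    Σℚ (suc n) (λ i → contribution x w (p i , q i)) +
    (Σℚ n (λ i → contribution x w (p (inject₁ i) , u i)) +
    (Σℚ n (λ i → contribution x w (u i , p (fs i))) +
    (Σℚ n (λ i → contribution x w (q (inject₁ i) , v i)) +
     Σℚ n (λ i → contribution x w (v i , q (fs i))))))
  laplacian-byEdgeClass n x w = begin
    laplacian n x w                          ≡⟨ laplacian-unfold n x w ⟩
    S (E₁ ++ E₂ ++ E₃ ++ E₄ ++ E₅)           ≡⟨ S-++ E₁ _ ⟩
    S E₁ + S (E₂ ++ E₃ ++ E₄ ++ E₅)          ≡⟨ cong (S E₁ +_) (S-++ E₂ _) ⟩
    S E₁ + (S E₂ + S (E₃ ++ E₄ ++ E₅))       ≡⟨ cong (λ s → S E₁ + (S E₂ + s)) (S-++ E₃ _) ⟩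
    S E₁ + (S E₂ + (S E₃ + S (E₄ ++ E₅)))    ≡⟨ cong (λ s → S E₁ + (S E₂ + (S E₃ + s))) (S-++ E₄ E₅) ⟩
    S E₁ + (S E₂ + (S E₃ + (S E₄ + S E₅)))   ≡⟨ cong₂ _+_ (S-map e₁) (cong₂ _+_ (S-map e₂) (cong₂ _+_ (S-map e₃)
                                                  (cong₂ _+_ (S-map e₄) (S-map e₅)))) ⟩
    _                                        ∎
    where
    open ≡-Reasoning
    S : List (V n × V n) → ℚ
    S l = sumℚ (map (contribution x w) l)
    S-++ : ∀ l₁ l₂ → S (l₁ ++ l₂) ≡ S l₁ + S l₂
    S-++ l₁ l₂ = trans (cong sumℚ (ListP.map-++ (contribution x w) l₁ l₂)) (sumℚ-++ (map (contribution x w) l₁) _)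
    S-map : ∀ {m} (e : Fin m → V n × V n) → S (map e (allFin m)) ≡ Σℚ m (λ i → contribution x w (e i))
    S-map {m} e = cong sumℚ (trans (sym (ListP.map-∘ (allFin m))) (ListP.map-tabulate id (contribution x w ∘ e)))
    e₁ : Fin (suc n) → V n × V n
    e₁ i = p i , q i
    e₂ e₃ e₄ e₅ : Fin n → V n × V n
    e₂ i = p (inject₁ i) , u i
    e₃ i = u i , p (fs i)
    e₄ i = q (inject₁ i) , v i
    e₅ i = v i , q (fs i)
    E₁ = map e₁ (allFin (suc n))
    E₂ = map e₂ (allFin n)
    E₃ = map e₃ (allFin n)
    E₄ = map e₄ (allFin n)
    E₅ = map e₅ (allFin n)

  indicator : Bool → ℚ
  indicator b = if b then 1ℚ else 0ℚ

  -- The edge to the right of p j (to u j) exists iff j < n, the edge to its left (to u (j - 1)) iff j > 0.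
  rightEdge : {A : Set} → A → ℕ → ℕ → (ℕ → A) → A
  rightEdge z zero j H = z
  rightEdge z (suc n) zero H = H 0
  rightEdge z (suc n) (suc j) H = rightEdge z n j (H ∘ suc)

  leftEdge : {A : Set} → A → (ℕ → A) → ℕ → A
  leftEdge z H zero = z
  leftEdge z H (suc j) = H j

  rightEdge-< : ∀ {A : Set} (z : A) n j H → j < n → rightEdge z n j H ≡ H j
  rightEdge-< z (suc n) zero H _ = refl
  rightEdge-< z (suc n) (suc j) H (s≤s j<n) = rightEdge-< z n j (H ∘ suc) j<n

  rightEdge-n : ∀ {A : Set} (z : A) n H → rightEdge z n n H ≡ z
  rightEdge-n z zero H = refl
  rightEdge-n z (suc n) H = rightEdge-n z n _

  rightEdge-map : ∀ {A B : Set} (f : A → B) {z : A} {z' : B} → f z ≡ z' → ∀ n j H H' → (∀ i → f (H i) ≡ H' i) →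
    f (rightEdge z n j H) ≡ rightEdge z' n j H'
  rightEdge-map f fz≡z' zero j H H' fH≗H' = fz≡z'
  rightEdge-map f fz≡z' (suc n) zero H H' fH≗H' = fH≗H' 0
  rightEdge-map f fz≡z' (suc n) (suc j) H H' fH≗H' = rightEdge-map f fz≡z' n j (H ∘ suc) (H' ∘ suc) (fH≗H' ∘ suc)

  leftEdge-map : ∀ {A B : Set} (f : A → B) {z : A} {z' : B} → f z ≡ z' → ∀ H H' → (∀ i → f (H i) ≡ H' i) → ∀ j →
    f (leftEdge z H j) ≡ leftEdge z' H' j
  leftEdge-map f fz≡z' H H' fH≗H' zero = fz≡z'
  leftEdge-map f fz≡z' H H' fH≗H' (suc j) = fH≗H' j

  rightEdge-cong : ∀ {A : Set} (z : A) n j (H H' : ℕ → A) → (∀ i → H i ≡ H' i) → rightEdge z n j H ≡ rightEdge z n j H'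
  rightEdge-cong z = rightEdge-map id refl

  leftEdge-cong : ∀ {A : Set} (z : A) j (H H' : ℕ → A) → (∀ i → H i ≡ H' i) → leftEdge z H j ≡ leftEdge z H' j
  leftEdge-cong z j H H' H≗H' = leftEdge-map id refl H H' H≗H' j

  rightEdge-0 : ∀ n j → rightEdge 0ℚ n j (λ _ → 0ℚ) ≡ 0ℚ
  rightEdge-0 zero j = refl
  rightEdge-0 (suc n) zero = refl
  rightEdge-0 (suc n) (suc j) = rightEdge-0 n j

  rightEdge-indicator : ∀ (a : ℚ) n j t → t < n →
    rightEdge 0ℚ n j (λ i → if i ≡ᵇ t then a else 0ℚ) ≡ (if j ≡ᵇ t then a else 0ℚ)
  rightEdge-indicator a (suc n) zero t t<n = refl
  rightEdge-indicator a (suc n) (suc j) zero t<n = rightEdge-0 n j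
  rightEdge-indicator a (suc n) (suc j) (suc t) (s≤s t<n) = rightEdge-indicator a n j t t<n

  leftEdge-indicator : ∀ (a : ℚ) j t → leftEdge 0ℚ (λ i → if i ≡ᵇ t then a else 0ℚ) j ≡ (if j ≡ᵇ suc t then a else 0ℚ)
  leftEdge-indicator a zero t = refl
  leftEdge-indicator a (suc j) t = refl

  Σℚ-0 : (m : ℕ) → Σℚ m (λ _ → 0ℚ + 0ℚ) ≡ 0ℚ
  Σℚ-0 zero = refl
  Σℚ-0 (suc m) = cong ((0ℚ + 0ℚ) +_) (Σℚ-0 m)

  Σℚ-indicatorˡ : (m : ℕ) (k : Fin m) (G : Fin m → ℚ) →
    Σℚ m (λ i → (if does (k Fin.≟ i) then G i else 0ℚ) + 0ℚ) ≡ G k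
  Σℚ-indicatorˡ (suc m) fz G = trans (cong ((G fz + 0ℚ) +_) (Σℚ-0 m)) (trans (ℚP.+-identityʳ _) (ℚP.+-identityʳ _))
  Σℚ-indicatorˡ (suc m) (fs k) G = trans (cong ((0ℚ + 0ℚ) +_) (Σℚ-indicatorˡ m k (G ∘ fs))) (ℚP.+-identityˡ _)

  Σℚ-indicatorʳ : (m : ℕ) (k : Fin m) (G : Fin m → ℚ) →
    Σℚ m (λ i → 0ℚ + (if does (k Fin.≟ i) then G i else 0ℚ)) ≡ G k
  Σℚ-indicatorʳ (suc m) fz G = trans (cong ((0ℚ + G fz) +_) (Σℚ-0 m)) (trans (ℚP.+-identityʳ _) (ℚP.+-identityˡ _))
  Σℚ-indicatorʳ (suc m) (fs k) G = trans (cong ((0ℚ + 0ℚ) +_) (Σℚ-indicatorʳ m k (G ∘ fs))) (ℚP.+-identityˡ _)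

  Σℚ-indicator-inject₁ : (m : ℕ) (k : Fin (suc m)) (G : Fin m → ℚ) (H : ℕ → ℚ) → (∀ i → G i ≡ H (toℕ i)) →
    Σℚ m (λ i → (if does (k Fin.≟ inject₁ i) then G i else 0ℚ) + 0ℚ) ≡ rightEdge 0ℚ m (toℕ k) H
  Σℚ-indicator-inject₁ zero fz G H G≗H = refl
  Σℚ-indicator-inject₁ (suc m) fz G H G≗H =
    trans (cong ((G fz + 0ℚ) +_) (Σℚ-0 m)) (trans (ℚP.+-identityʳ _) (trans (ℚP.+-identityʳ _) (G≗H fz)))
  Σℚ-indicator-inject₁ (suc m) (fs k) G H G≗H =
    trans (cong ((0ℚ + 0ℚ) +_) (Σℚ-indicator-inject₁ m k (G ∘ fs) (H ∘ suc) (G≗H ∘ fs))) (ℚP.+-identityˡ _)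

  Σℚ-indicator-suc : (m : ℕ) (k : Fin (suc m)) (H : ℕ → ℚ) →
    Σℚ m (λ i → 0ℚ + (if does (k Fin.≟ fs i) then H (toℕ i) else 0ℚ)) ≡ leftEdge 0ℚ H (toℕ k)
  Σℚ-indicator-suc zero fz H = refl
  Σℚ-indicator-suc (suc m) fz H = cong ((0ℚ + 0ℚ) +_) (Σℚ-0 m)
  Σℚ-indicator-suc (suc m) (fs k) H = Σℚ-indicatorʳ (suc m) k (H ∘ toℕ)

  fromSequences : {A : Set} → (n : ℕ) → (ℕ → A) → (ℕ → A) → (ℕ → A) → (ℕ → A) → V n → A
  fromSequences n P Q U W (p k) = P (toℕ k)
  fromSequences n P Q U W (q k) = Q (toℕ k)
  fromSequences n P Q U W (u k) = U (toℕ k)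
  fromSequences n P Q U W (v k) = W (toℕ k)

  module _ (n : ℕ) (P Q U W : ℕ → ℚ) where

    private
      x = fromSequences n P Q U W

    laplacian-p : (k : Fin (suc n)) → laplacian n x (p k) ≡
      (P (toℕ k) - Q (toℕ k)) + (rightEdge 0ℚ n (toℕ k) (λ j → P j - U j) + (leftEdge 0ℚ (λ j → P (suc j) - U j) (toℕ k) + 0ℚ))
    laplacian-p k = trans (laplacian-byEdgeClass n x (p k))
      (cong₂ _+_ (Σℚ-indicatorˡ (suc n) k (λ i → P (toℕ i) - Q (toℕ i)))
        (cong₂ _+_ (Σℚ-indicator-inject₁ n k _ (λ j → P j - U j) (λ i → cong (λ j → P j - U (toℕ i)) (FinP.toℕ-inject₁ i)))
          (cong₂ _+_ (Σℚ-indicator-suc n k (λ j → P (suc j) - U j)) (cong₂ _+_ (Σℚ-0 n) (Σℚ-0 n)))))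

    laplacian-q : (k : Fin (suc n)) → laplacian n x (q k) ≡
      (Q (toℕ k) - P (toℕ k)) + (0ℚ + (0ℚ + (rightEdge 0ℚ n (toℕ k) (λ j → Q j - W j) + leftEdge 0ℚ (λ j → Q (suc j) - W j) (toℕ k))))
    laplacian-q k = trans (laplacian-byEdgeClass n x (q k))
      (cong₂ _+_ (Σℚ-indicatorʳ (suc n) k (λ i → Q (toℕ i) - P (toℕ i)))
        (cong₂ _+_ (Σℚ-0 n) (cong₂ _+_ (Σℚ-0 n)
          (cong₂ _+_ (Σℚ-indicator-inject₁ n k _ (λ j → Q j - W j) (λ i → cong (λ j → Q j - W (toℕ i)) (FinP.toℕ-inject₁ i)))
            (Σℚ-indicator-suc n k (λ j → Q (suc j) - W j))))))

    laplacian-u : (k : Fin n) → laplacian n x (u k) ≡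
      0ℚ + ((U (toℕ k) - P (toℕ k)) + ((U (toℕ k) - P (suc (toℕ k))) + (0ℚ + 0ℚ)))
    laplacian-u k = trans (laplacian-byEdgeClass n x (u k))
      (cong₂ _+_ (Σℚ-0 (suc n))
        (cong₂ _+_ (trans (Σℚ-indicatorʳ n k _) (cong (λ j → U (toℕ k) - P j) (FinP.toℕ-inject₁ k)))
          (cong₂ _+_ (Σℚ-indicatorˡ n k _) (cong₂ _+_ (Σℚ-0 n) (Σℚ-0 n)))))

    laplacian-v : (k : Fin n) → laplacian n x (v k) ≡
      0ℚ + (0ℚ + (0ℚ + ((W (toℕ k) - Q (toℕ k)) + (W (toℕ k) - Q (suc (toℕ k))))))
    laplacian-v k = trans (laplacian-byEdgeClass n x (v k))
      (cong₂ _+_ (Σℚ-0 (suc n))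
        (cong₂ _+_ (Σℚ-0 n) (cong₂ _+_ (Σℚ-0 n)
          (cong₂ _+_ (trans (Σℚ-indicatorʳ n k _) (cong (λ j → W (toℕ k) - Q j) (FinP.toℕ-inject₁ k)))
            (Σℚ-indicatorˡ n k _)))))

module Harmonic where

  open import Defs
  open SqrtTwo using (ℚ-ring; *-≢0)
  open Laplacian
  open import Data.Nat using (ℕ; zero; suc; _≤_; _<_; s≤s)
  import Data.Nat.Properties as ℕP
  open import Data.Fin using (Fin; toℕ; fromℕ<) renaming (zero to fz; suc to fs)
  import Data.Fin.Properties as FinP
  open import Data.Rational using (ℚ; 0ℚ; 1ℚ; ½; _+_; _-_; _*_) renaming (_≤_ to _≤ℚ_; _<_ to _<ℚ_)
  import Data.Rational.Properties as ℚP
  open import Data.List using ([]; _∷_)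
  open import Data.Product using (_×_; _,_)
  open import Relation.Nullary using (yes; no; contradiction)
  open import Relation.Nullary.Decidable using (toWitness)
  open import Relation.Binary.PropositionalEquality
  open import Tactic.RingSolver using (solve)

  clamp : (n m : ℕ) → Fin (suc n)
  clamp n zero = fz
  clamp zero (suc m) = fz
  clamp (suc n) (suc m) = fs (clamp n m)

  clamp-toℕ : ∀ n (k : Fin (suc n)) → clamp n (toℕ k) ≡ k
  clamp-toℕ n fz = refl
  clamp-toℕ (suc n) (fs k) = cong fs (clamp-toℕ n k)

  toℕ-clamp : ∀ n j → j ≤ n → toℕ (clamp n j) ≡ j
  toℕ-clamp n zero _ = refl
  toℕ-clamp (suc n) (suc j) (s≤s h) = cong suc (toℕ-clamp n j h)

  atClamp : (n : ℕ) → (Fin n → ℚ) → ℕ → ℚ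
  atClamp zero f j = 0ℚ
  atClamp (suc n) f j = f (clamp n j)

  atClamp-toℕ : ∀ n (f : Fin n → ℚ) (k : Fin n) → atClamp n f (toℕ k) ≡ f k
  atClamp-toℕ (suc n) f k = cong f (clamp-toℕ n k)

  mutual
    currentFactor : ℕ → ℚ
    currentFactor zero = 0ℚ
    currentFactor (suc j) = gapFactor j + gapFactor j + currentFactor j
    gapFactor : ℕ → ℚ
    gapFactor zero = 1ℚ
    gapFactor (suc j) = gapFactor j + (currentFactor (suc j) + currentFactor (suc j))

  0≤1 : 0ℚ ≤ℚ 1ℚ
  0≤1 = toWitness {a? = 0ℚ ℚP.≤? 1ℚ} _

  factor-bounds : ∀ j → (1ℚ ≤ℚ gapFactor j) × (0ℚ ≤ℚ currentFactor j)
  factor-bounds zero = ℚP.≤-refl , ℚP.≤-refl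
  factor-bounds (suc j) with factor-bounds j
  ... | 1≤a , 0≤c = 1≤a′ , 0≤c′
    where
    0≤c′ : 0ℚ ≤ℚ currentFactor (suc j)
    0≤c′ = ℚP.+-mono-≤ (ℚP.+-mono-≤ (ℚP.≤-trans 0≤1 1≤a) (ℚP.≤-trans 0≤1 1≤a)) 0≤c
    1≤a′ : 1ℚ ≤ℚ gapFactor (suc j)
    1≤a′ = ℚP.+-mono-≤ 1≤a (ℚP.+-mono-≤ 0≤c′ 0≤c′)

  boundaryFactor-positive : ∀ j → 0ℚ <ℚ gapFactor j + gapFactor j + currentFactor j
  boundaryFactor-positive j with factor-bounds j
  ... | 1≤a , 0≤c = ℚP.<-≤-trans (toWitness {a? = 0ℚ ℚP.<? (1ℚ + 1ℚ + 0ℚ)} _) (ℚP.+-mono-≤ (ℚP.+-mono-≤ 1≤a 1≤a) 0≤c)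

  p≡q⇒p-q≡0 : ∀ {a b : ℚ} → a ≡ b → a - b ≡ 0ℚ
  p≡q⇒p-q≡0 {a} refl = ℚP.+-inverseʳ a

  zero-factor : ∀ {d t : ℚ} → 0ℚ <ℚ t → d * t ≡ 0ℚ → d ≡ 0ℚ
  zero-factor {d} {t} 0<t dt≡0 with d ℚP.≟ 0ℚ
  ... | yes d≡0 = d≡0
  ... | no d≢0 = contradiction dt≡0 (*-≢0 d≢0 λ t≡0 → ℚP.<-irrefl (sym t≡0) 0<t)

  -- Each identity writes a quantity at rung j + 1 as its predicted value plus a combination of
  -- defects: invariant equations at rung j and vertex balances at rung j, all zero when x is harmonic.
  cut-current-step : ∀ Pj Qj Uj Wj Fj Gj P1 Q1 →
    (P1 - Uj) + (Q1 - Wj) ≡ (Fj + Gj) - (((Pj - Qj) + ((Pj - Uj) + (Fj + 0ℚ))) + (((Qj - Pj) + (0ℚ + (0ℚ + ((Qj - Wj) + Gj)))) +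
        ((0ℚ + ((Uj - Pj) + ((Uj - P1) + (0ℚ + 0ℚ)))) + (0ℚ + (0ℚ + (0ℚ + ((Wj - Qj) + (Wj - Q1))))))))
  cut-current-step Pj Qj Uj Wj Fj Gj P1 Q1 = solve (Pj ∷ Qj ∷ Uj ∷ Wj ∷ Fj ∷ Gj ∷ P1 ∷ Q1 ∷ []) ℚ-ring

  rail-sum-step : ∀ Pj Qj Uj Wj P1 Q1 P0 Q0 →
    P1 + Q1 ≡ (P0 + Q0) + ((((Pj + Qj) - (P0 + Q0)) + (1ℚ + 1ℚ) * ((P1 - Uj) + (Q1 - Wj))) +
       ((0ℚ + ((Uj - Pj) + ((Uj - P1) + (0ℚ + 0ℚ)))) + (0ℚ + (0ℚ + (0ℚ + ((Wj - Qj) + (Wj - Q1)))))))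
  rail-sum-step Pj Qj Uj Wj P1 Q1 P0 Q0 = solve (Pj ∷ Qj ∷ Uj ∷ Wj ∷ P1 ∷ Q1 ∷ P0 ∷ Q0 ∷ []) ℚ-ring

  current-gap-step : ∀ Pj Qj Uj Wj Fj Gj P1 Q1 P0 Q0 aj cj →
    (P1 - Uj) - (Q1 - Wj) ≡ (P0 - Q0) * (aj + aj + cj) +
     (((1ℚ + 1ℚ) * ((Pj - Qj) - (P0 - Q0) * aj) + ((Fj - Gj) - (P0 - Q0) * cj)) +
     ((((Qj - Pj) + (0ℚ + (0ℚ + ((Qj - Wj) + Gj)))) + (0ℚ + (0ℚ + (0ℚ + ((Wj - Qj) + (Wj - Q1))))))
      - (((Pj - Qj) + ((Pj - Uj) + (Fj + 0ℚ))) + (0ℚ + ((Uj - Pj) + ((Uj - P1) + (0ℚ + 0ℚ)))))))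
  current-gap-step Pj Qj Uj Wj Fj Gj P1 Q1 P0 Q0 aj cj = solve (Pj ∷ Qj ∷ Uj ∷ Wj ∷ Fj ∷ Gj ∷ P1 ∷ Q1 ∷ P0 ∷ Q0 ∷ aj ∷ cj ∷ []) ℚ-ring

  rail-gap-step : ∀ Pj Qj Uj Wj P1 Q1 P0 Q0 aj c1 →
    P1 - Q1 ≡ (P0 - Q0) * (aj + (c1 + c1)) +
     (((Pj - Qj) - (P0 - Q0) * aj) + ((1ℚ + 1ℚ) * (((P1 - Uj) - (Q1 - Wj)) - (P0 - Q0) * c1) +
      ((0ℚ + ((Uj - Pj) + ((Uj - P1) + (0ℚ + 0ℚ)))) - (0ℚ + (0ℚ + (0ℚ + ((Wj - Qj) + (Wj - Q1))))))))
  rail-gap-step Pj Qj Uj Wj P1 Q1 P0 Q0 aj c1 = solve (Pj ∷ Qj ∷ Uj ∷ Wj ∷ P1 ∷ Q1 ∷ P0 ∷ Q0 ∷ aj ∷ c1 ∷ []) ℚ-ring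

  boundary-gap : ∀ Pn Qn Fn Gn P0 Q0 an cn →
    (P0 - Q0) * (an + an + cn) ≡
     (((Pn - Qn) + (0ℚ + (Fn + 0ℚ))) - ((Qn - Pn) + (0ℚ + (0ℚ + (0ℚ + Gn)))))
     - ((1ℚ + 1ℚ) * ((Pn - Qn) - (P0 - Q0) * an) + ((Fn - Gn) - (P0 - Q0) * cn))
  boundary-gap Pn Qn Fn Gn P0 Q0 an cn = solve (Pn ∷ Qn ∷ Fn ∷ Gn ∷ P0 ∷ Q0 ∷ an ∷ cn ∷ []) ℚ-ring

  p-from-invariants : ∀ Pj Qj P0 Q0 aj →
    Pj ≡ P0 + (½ * ((Pj + Qj) - (P0 + Q0)) + (½ * ((Pj - Qj) - (P0 - Q0) * aj) + ((½ * aj + ½) * (P0 - Q0) - (P0 - Q0))))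
  p-from-invariants Pj Qj P0 Q0 aj = solve (Pj ∷ Qj ∷ P0 ∷ Q0 ∷ aj ∷ []) ℚ-ring

  q-from-invariants : ∀ Pj Qj P0 Q0 aj →
    Qj ≡ P0 + (½ * ((Pj + Qj) - (P0 + Q0)) - (½ * ((Pj - Qj) - (P0 - Q0) * aj) + ((½ * aj + ½) * (P0 - Q0))))
  q-from-invariants Pj Qj P0 Q0 aj = solve (Pj ∷ Qj ∷ P0 ∷ Q0 ∷ aj ∷ []) ℚ-ring

  u-from-neighbours : ∀ Uj Pj P1 P0 →
    Uj ≡ P0 + (½ * (Pj - P0) + (½ * (P1 - P0) + ½ * (0ℚ + ((Uj - Pj) + ((Uj - P1) + (0ℚ + 0ℚ))))))
  u-from-neighbours Uj Pj P1 P0 = solve (Uj ∷ Pj ∷ P1 ∷ P0 ∷ []) ℚ-ring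

  v-from-neighbours : ∀ Wj Qj Q1 P0 →
    Wj ≡ P0 + (½ * (Qj - P0) + (½ * (Q1 - P0) + ½ * (0ℚ + (0ℚ + (0ℚ + ((Wj - Qj) + (Wj - Q1)))))))
  v-from-neighbours Wj Qj Q1 P0 = solve (Wj ∷ Qj ∷ Q1 ∷ P0 ∷ []) ℚ-ring

  record TransferInvariant (P Q U W : ℕ → ℚ) (j : ℕ) : Set where
    field
      cut-current : leftEdge 0ℚ (λ i → P (suc i) - U i) j + leftEdge 0ℚ (λ i → Q (suc i) - W i) j ≡ 0ℚ
      rail-sum : P j + Q j ≡ P 0 + Q 0
      rail-gap : P j - Q j ≡ (P 0 - Q 0) * gapFactor j
      current-gap : leftEdge 0ℚ (λ i → P (suc i) - U i) j - leftEdge 0ℚ (λ i → Q (suc i) - W i) j ≡ (P 0 - Q 0) * currentFactor j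

  module HarmonicIsConstant (n : ℕ) (x : V n → ℚ) (harm : ∀ w → laplacian n x w ≡ 0ℚ) where
    P Q U W : ℕ → ℚ
    P j = x (p (clamp n j))
    Q j = x (q (clamp n j))
    U = atClamp n (λ i → x (u i))
    W = atClamp n (λ i → x (v i))

    X : V n → ℚ
    X = fromSequences n P Q U W

    x≡X : ∀ w → x w ≡ X w
    x≡X (p k) = cong (λ k → x (p k)) (sym (clamp-toℕ n k))
    x≡X (q k) = cong (λ k → x (q k)) (sym (clamp-toℕ n k))
    x≡X (u k) = sym (atClamp-toℕ n (λ i → x (u i)) k)
    x≡X (v k) = sym (atClamp-toℕ n (λ i → x (v i)) k)

    harmonic-X : ∀ w → laplacian n X w ≡ 0ℚ
    harmonic-X w = trans (sym (laplacian-cong n x X x≡X w)) (harm w)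

    F G : ℕ → ℚ
    F = leftEdge 0ℚ (λ i → P (suc i) - U i)
    G = leftEdge 0ℚ (λ i → Q (suc i) - W i)

    balance-p : ∀ j → j ≤ n → (P j - Q j) + (rightEdge 0ℚ n j (λ i → P i - U i) + (F j + 0ℚ)) ≡ 0ℚ
    balance-p j h = subst (λ t → (P t - Q t) + (rightEdge 0ℚ n t (λ i → P i - U i) + (F t + 0ℚ)) ≡ 0ℚ)
      (toℕ-clamp n j h) (trans (sym (laplacian-p n P Q U W (clamp n j))) (harmonic-X (p (clamp n j))))

    balance-q : ∀ j → j ≤ n → (Q j - P j) + (0ℚ + (0ℚ + (rightEdge 0ℚ n j (λ i → Q i - W i) + G j))) ≡ 0ℚ
    balance-q j h = subst (λ t → (Q t - P t) + (0ℚ + (0ℚ + (rightEdge 0ℚ n t (λ i → Q i - W i) + G t)))  ≡ 0ℚ)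
      (toℕ-clamp n j h) (trans (sym (laplacian-q n P Q U W (clamp n j))) (harmonic-X (q (clamp n j))))

    balance-u : ∀ j → j < n → 0ℚ + ((U j - P j) + ((U j - P (suc j)) + (0ℚ + 0ℚ))) ≡ 0ℚ
    balance-u j h = subst (λ t → 0ℚ + ((U t - P t) + ((U t - P (suc t)) + (0ℚ + 0ℚ))) ≡ 0ℚ)
      (FinP.toℕ-fromℕ< h) (trans (sym (laplacian-u n P Q U W (fromℕ< h))) (harmonic-X (u (fromℕ< h))))

    balance-v : ∀ j → j < n → 0ℚ + (0ℚ + (0ℚ + ((W j - Q j) + (W j - Q (suc j))))) ≡ 0ℚ
    balance-v j h = subst (λ t → 0ℚ + (0ℚ + (0ℚ + ((W t - Q t) + (W t - Q (suc t))))) ≡ 0ℚ)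
      (FinP.toℕ-fromℕ< h) (trans (sym (laplacian-v n P Q U W (fromℕ< h))) (harmonic-X (v (fromℕ< h))))

    balance-p-interior : ∀ j → j < n → (P j - Q j) + ((P j - U j) + (F j + 0ℚ)) ≡ 0ℚ
    balance-p-interior j h = trans (cong (λ t → (P j - Q j) + (t + (F j + 0ℚ))) (sym (rightEdge-< 0ℚ n j (λ i → P i - U i) h))) (balance-p j (ℕP.<⇒≤ h))

    balance-q-interior : ∀ j → j < n → (Q j - P j) + (0ℚ + (0ℚ + ((Q j - W j) + G j))) ≡ 0ℚ
    balance-q-interior j h = trans (cong (λ t → (Q j - P j) + (0ℚ + (0ℚ + (t + G j)))) (sym (rightEdge-< 0ℚ n j (λ i → Q i - W i) h))) (balance-q j (ℕP.<⇒≤ h))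

    invariant-0 : TransferInvariant P Q U W 0
    invariant-0 = record { cut-current = refl ; rail-sum = refl ; rail-gap = sym (ℚP.*-identityʳ _) ; current-gap = sym (ℚP.*-zeroʳ (P 0 - Q 0)) }

    invariant-step : ∀ j → j < n → TransferInvariant P Q U W j → TransferInvariant P Q U W (suc j)
    invariant-step j h I = record { cut-current = cut-current′ ; rail-sum = rail-sum′ ; rail-gap = rail-gap′ ; current-gap = current-gap′ }
      where
      open TransferInvariant I
      bal-p = balance-p-interior j h
      bal-q = balance-q-interior j h
      bal-u = balance-u j h
      bal-v = balance-v j h
      cut-current′ : (P (suc j) - U j) + (Q (suc j) - W j) ≡ 0ℚ
      cut-current′ = trans (cut-current-step (P j) (Q j) (U j) (W j) (F j) (G j) (P (suc j)) (Q (suc j)))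
        (cong₂ _-_ cut-current (cong₂ _+_ bal-p (cong₂ _+_ bal-q (cong₂ _+_ bal-u bal-v))))
      rail-sum′ : P (suc j) + Q (suc j) ≡ P 0 + Q 0
      rail-sum′ = trans (rail-sum-step (P j) (Q j) (U j) (W j) (P (suc j)) (Q (suc j)) (P 0) (Q 0))
        (trans (cong (λ z → (P 0 + Q 0) + z) (cong₂ _+_ (cong₂ _+_ (p≡q⇒p-q≡0 rail-sum) (cong ((1ℚ + 1ℚ) *_) cut-current′)) (cong₂ _+_ bal-u bal-v)))
          (ℚP.+-identityʳ _))
      current-gap′ : (P (suc j) - U j) - (Q (suc j) - W j) ≡ (P 0 - Q 0) * currentFactor (suc j)
      current-gap′ = trans (current-gap-step (P j) (Q j) (U j) (W j) (F j) (G j) (P (suc j)) (Q (suc j)) (P 0) (Q 0) (gapFactor j) (currentFactor j))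
        (trans (cong (λ z → (P 0 - Q 0) * currentFactor (suc j) + z)
          (cong₂ _+_ (cong₂ _+_ (cong ((1ℚ + 1ℚ) *_) (p≡q⇒p-q≡0 rail-gap)) (p≡q⇒p-q≡0 current-gap)) (cong₂ _-_ (cong₂ _+_ bal-q bal-v) (cong₂ _+_ bal-p bal-u))))
          (ℚP.+-identityʳ _))
      rail-gap′ : P (suc j) - Q (suc j) ≡ (P 0 - Q 0) * gapFactor (suc j)
      rail-gap′ = trans (rail-gap-step (P j) (Q j) (U j) (W j) (P (suc j)) (Q (suc j)) (P 0) (Q 0) (gapFactor j) (currentFactor (suc j)))
        (trans (cong (λ z → (P 0 - Q 0) * gapFactor (suc j) + z)
          (cong₂ _+_ (p≡q⇒p-q≡0 rail-gap) (cong₂ _+_ (cong ((1ℚ + 1ℚ) *_) (p≡q⇒p-q≡0 current-gap′)) (cong₂ _-_ bal-u bal-v))))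
          (ℚP.+-identityʳ _))

    invariant : ∀ j → j ≤ n → TransferInvariant P Q U W j
    invariant zero _ = invariant-0
    invariant (suc j) h = invariant-step j h (invariant j (ℕP.<⇒≤ h))

    p₀≡q₀ : P 0 - Q 0 ≡ 0ℚ
    p₀≡q₀ = zero-factor (boundaryFactor-positive n) (trans (boundary-gap (P n) (Q n) (F n) (G n) (P 0) (Q 0) (gapFactor n) (currentFactor n))
           (cong₂ _-_ (cong₂ _-_ balance-p-end balance-q-end) (cong₂ _+_ (cong ((1ℚ + 1ℚ) *_) (p≡q⇒p-q≡0 rail-gap)) (p≡q⇒p-q≡0 current-gap))))
      where
      open TransferInvariant (invariant n ℕP.≤-refl)
      balance-p-end : (P n - Q n) + (0ℚ + (F n + 0ℚ)) ≡ 0ℚ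
      balance-p-end = trans (cong (λ t → (P n - Q n) + (t + (F n + 0ℚ))) (sym (rightEdge-n 0ℚ n (λ i → P i - U i)))) (balance-p n ℕP.≤-refl)
      balance-q-end : (Q n - P n) + (0ℚ + (0ℚ + (0ℚ + G n))) ≡ 0ℚ
      balance-q-end = trans (cong (λ t → (Q n - P n) + (0ℚ + (0ℚ + (t + G n))))  (sym (rightEdge-n 0ℚ n (λ i → Q i - W i)))) (balance-q n ℕP.≤-refl)

    p-constant : ∀ j → j ≤ n → P j ≡ P 0
    p-constant j h = trans (p-from-invariants (P j) (Q j) (P 0) (Q 0) (gapFactor j))
      (trans (cong (λ z → P 0 + z) (cong₂ _+_ (cong (½ *_) (p≡q⇒p-q≡0 rail-sum)) (cong₂ _+_ (cong (½ *_) (p≡q⇒p-q≡0 rail-gap))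
         (trans (cong₂ _-_ (trans (cong ((½ * gapFactor j + ½) *_) p₀≡q₀) (ℚP.*-zeroʳ (½ * gapFactor j + ½))) p₀≡q₀) refl))))
       (ℚP.+-identityʳ _))
      where open TransferInvariant (invariant j h)

    q-constant : ∀ j → j ≤ n → Q j ≡ P 0
    q-constant j h = trans (q-from-invariants (P j) (Q j) (P 0) (Q 0) (gapFactor j))
      (trans (cong (λ z → P 0 + z) (cong₂ _-_ (cong (½ *_) (p≡q⇒p-q≡0 rail-sum)) (cong₂ _+_ (cong (½ *_) (p≡q⇒p-q≡0 rail-gap))
         (trans (cong ((½ * gapFactor j + ½) *_) p₀≡q₀) (ℚP.*-zeroʳ (½ * gapFactor j + ½))))))
       (ℚP.+-identityʳ _))
      where open TransferInvariant (invariant j h)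

    u-constant : ∀ j → j < n → U j ≡ P 0
    u-constant j h = trans (u-from-neighbours (U j) (P j) (P (suc j)) (P 0))
      (trans (cong (λ z → P 0 + z) (cong₂ _+_ (cong (½ *_) (p≡q⇒p-q≡0 (p-constant j (ℕP.<⇒≤ h))))
        (cong₂ _+_ (cong (½ *_) (p≡q⇒p-q≡0 (p-constant (suc j) h))) (cong (½ *_) (balance-u j h)))))
       (ℚP.+-identityʳ _))

    v-constant : ∀ j → j < n → W j ≡ P 0
    v-constant j h = trans (v-from-neighbours (W j) (Q j) (Q (suc j)) (P 0))
      (trans (cong (λ z → P 0 + z) (cong₂ _+_ (cong (½ *_) (p≡q⇒p-q≡0 (q-constant j (ℕP.<⇒≤ h))))
        (cong₂ _+_ (cong (½ *_) (p≡q⇒p-q≡0 (q-constant (suc j) h))) (cong (½ *_) (balance-v j h)))))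
       (ℚP.+-identityʳ _))

    constant : ∀ w → x w ≡ P 0
    constant (p k) = trans (x≡X (p k)) (p-constant (toℕ k) (ℕP.≤-pred (FinP.toℕ<n k)))
    constant (q k) = trans (x≡X (q k)) (q-constant (toℕ k) (ℕP.≤-pred (FinP.toℕ<n k)))
    constant (u k) = trans (x≡X (u k)) (u-constant (toℕ k) (FinP.toℕ<n k))
    constant (v k) = trans (x≡X (v k)) (v-constant (toℕ k) (FinP.toℕ<n k))

  harmonic⇒constant : ∀ n (x : V n → ℚ) → (∀ w → laplacian n x w ≡ 0ℚ) → ∀ a b → x a ≡ x b
  harmonic⇒constant n x h a b = trans (HarmonicIsConstant.constant n x h a) (sym (HarmonicIsConstant.constant n x h b))

module Resistance where

  open import Defs
  open SqrtTwo using (ℚ-ring; 0ℚ√2)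
  open Laplacian
  open Harmonic using (harmonic⇒constant; p≡q⇒p-q≡0)
  open import Data.Nat using (ℕ; suc; _≤_; _<_)
  open import Data.Fin using (toℕ)
  import Data.Fin.Properties as FinP
  open import Data.Rational using (ℚ; 0ℚ; 1ℚ; _+_; _-_; _*_; -_)
  import Data.Rational.Properties as ℚP
  open import Data.List using ([]; _∷_)
  open import Relation.Binary.PropositionalEquality
  open import Function using (_∘_)
  open import Tactic.RingSolver using (solve)

  cong₃ : ∀ {A B C D : Set} (f : A → B → C → D) {a a′ b b′ c c′} →
    a ≡ a′ → b ≡ b′ → c ≡ c′ → f a b c ≡ f a′ b′ c′
  cong₃ f refl refl refl = refl

  cong₄ : ∀ {A B C D E : Set} (f : A → B → C → D → E) {a a′ b b′ c c′ d d′} →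
    a ≡ a′ → b ≡ b′ → c ≡ c′ → d ≡ d′ → f a b c d ≡ f a′ b′ c′ d′
  cong₄ f refl refl refl refl = refl

  potential-difference-unique : ∀ {n} {a b : V n} (x y : V n → ℚ) →
    IsPotential n a b x → IsPotential n a b y → x a - x b ≡ y a - y b
  potential-difference-unique {n} {a} {b} x y x-pot y-pot = begin
    x a - x b                          ≡⟨ split (x a) (x b) (y a) (y b) ⟩
    (h a - h b) + (y a - y b)          ≡⟨ cong (_+ (y a - y b)) (p≡q⇒p-q≡0 (harmonic⇒constant n h h-harmonic a b)) ⟩
    0ℚ + (y a - y b)                   ≡⟨ ℚP.+-identityˡ _ ⟩
    y a - y b                          ∎
    where
    open ≡-Reasoning
    h : V n → ℚ
    h w = 1ℚ * x w + (- 1ℚ) * y w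
    h-harmonic : ∀ w → laplacian n h w ≡ 0ℚ
    h-harmonic w = trans (laplacian-linear 1ℚ (- 1ℚ) x y w)
      (trans (cong₂ (λ s t → 1ℚ * s + (- 1ℚ) * t) (x-pot w) (y-pot w)) (cancel (δ a w - δ b w)))
      where
      cancel : ∀ c → 1ℚ * c + (- 1ℚ) * c ≡ 0ℚ
      cancel c = solve (c ∷ []) ℚ-ring
    split : ∀ xa xb ya yb → xa - xb ≡ ((1ℚ * xa + (- 1ℚ) * ya) - (1ℚ * xb + (- 1ℚ) * yb)) + (ya - yb)
    split xa xb ya yb = solve (xa ∷ xb ∷ ya ∷ yb ∷ []) ℚ-ring

  resistanceIs : ∀ {n} {a b : V n} {ρ : ℚ√2} (x : V n → ℚ) → IsPotential n a b x → embed (x a - x b) ≡ ρ →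
    ResistanceIs n a b ρ
  resistanceIs x x-pot x-value = record
    { potential = x
    ; isPotential = x-pot
    ; unique = λ y y-pot → trans (cong embed (potential-difference-unique y x y-pot x-pot)) x-value }

  combination₃ : ∀ {n} → ℚ → ℚ → ℚ → (V n → ℚ) → (V n → ℚ) → (V n → ℚ) → V n → ℚ
  combination₃ a b c x y z w = a * x w + (b * y w + c * z w)

  embed-combination₃-difference : ∀ {n} a b c (x y z : V n → ℚ) s t →
    embed (combination₃ a b c x y z s - combination₃ a b c x y z t)
      ≡ embed a ⊗ embed (x s - x t) ⊕ (embed b ⊗ embed (y s - y t) ⊕ embed c ⊗ embed (z s - z t))
  embed-combination₃-difference a b c x y z s t =
    cong₂ _⊹_ (re-part a b c (x s) (x t) (y s) (y t) (z s) (z t)) (im-part a b c (x s - x t) (y s - y t) (z s - z t))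
    where
    re-part : ∀ a b c xs xt ys yt zs zt → (a * xs + (b * ys + c * zs)) - (a * xt + (b * yt + c * zt))
      ≡ (a * (xs - xt) + (1ℚ + 1ℚ) * (0ℚ * 0ℚ)) + ((b * (ys - yt) + (1ℚ + 1ℚ) * (0ℚ * 0ℚ)) + (c * (zs - zt) + (1ℚ + 1ℚ) * (0ℚ * 0ℚ)))
    re-part a b c xs xt ys yt zs zt = solve (a ∷ b ∷ c ∷ xs ∷ xt ∷ ys ∷ yt ∷ zs ∷ zt ∷ []) ℚ-ring
    im-part : ∀ a b c r s t → 0ℚ ≡ (a * 0ℚ + 0ℚ * r) + ((b * 0ℚ + 0ℚ * s) + (c * 0ℚ + 0ℚ * t))
    im-part a b c r s t = solve (a ∷ b ∷ c ∷ r ∷ s ∷ t ∷ []) ℚ-ring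

  -- The right-hand sides of laplacian-p … laplacian-v, read in ℚ(√2).
  module ℚ√2-Laplacian (n : ℕ) (P Q U W : ℕ → ℚ√2) where

    laplacian√2-p laplacian√2-q laplacian√2-u laplacian√2-v : ℕ → ℚ√2
    laplacian√2-p j = (P j ⊖ Q j) ⊕ (rightEdge 0ℚ√2 n j (λ i → P i ⊖ U i) ⊕ (leftEdge 0ℚ√2 (λ i → P (suc i) ⊖ U i) j ⊕ 0ℚ√2))
    laplacian√2-q j = (Q j ⊖ P j) ⊕ (0ℚ√2 ⊕ (0ℚ√2 ⊕ (rightEdge 0ℚ√2 n j (λ i → Q i ⊖ W i) ⊕ leftEdge 0ℚ√2 (λ i → Q (suc i) ⊖ W i) j)))
    laplacian√2-u j = 0ℚ√2 ⊕ ((U j ⊖ P j) ⊕ ((U j ⊖ P (suc j)) ⊕ (0ℚ√2 ⊕ 0ℚ√2)))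
    laplacian√2-v j = 0ℚ√2 ⊕ (0ℚ√2 ⊕ (0ℚ√2 ⊕ ((W j ⊖ Q j) ⊕ (W j ⊖ Q (suc j)))))

    X : V n → ℚ√2
    X = fromSequences n P Q U W

    component : (ℚ√2 → ℚ) → V n → ℚ
    component π = fromSequences n (π ∘ P) (π ∘ Q) (π ∘ U) (π ∘ W)

    private
      module _ (π : ℚ√2 → ℚ) (π-0 : π 0ℚ√2 ≡ 0ℚ) (π-⊖ : ∀ a b → π (a ⊖ b) ≡ π a - π b) where

        laplacian-component-p : ∀ k → laplacian n (component π) (p k) ≡
          (π (P (toℕ k)) - π (Q (toℕ k))) +
          (π (rightEdge 0ℚ√2 n (toℕ k) (λ i → P i ⊖ U i)) + (π (leftEdge 0ℚ√2 (λ i → P (suc i) ⊖ U i) (toℕ k)) + 0ℚ))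
        laplacian-component-p k = trans (laplacian-p n _ _ _ _ k) (cong ((π (P (toℕ k)) - π (Q (toℕ k))) +_) (cong₂ _+_
          (sym (rightEdge-map π π-0 n (toℕ k) _ _ (λ i → π-⊖ (P i) (U i))))
          (cong (_+ 0ℚ) (sym (leftEdge-map π π-0 _ _ (λ i → π-⊖ (P (suc i)) (U i)) (toℕ k))))))

        laplacian-component-q : ∀ k → laplacian n (component π) (q k) ≡
          (π (Q (toℕ k)) - π (P (toℕ k))) +
          (0ℚ + (0ℚ + (π (rightEdge 0ℚ√2 n (toℕ k) (λ i → Q i ⊖ W i)) + π (leftEdge 0ℚ√2 (λ i → Q (suc i) ⊖ W i) (toℕ k)))))
        laplacian-component-q k = trans (laplacian-q n _ _ _ _ k) (cong (λ z → (π (Q (toℕ k)) - π (P (toℕ k))) + (0ℚ + (0ℚ + z)))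
          (cong₂ _+_ (sym (rightEdge-map π π-0 n (toℕ k) _ _ (λ i → π-⊖ (Q i) (W i))))
                     (sym (leftEdge-map π π-0 _ _ (λ i → π-⊖ (Q (suc i)) (W i)) (toℕ k)))))

    module RationalSolution (ρp ρq ρu ρv : ℕ → ℚ)
      (solves-p : ∀ j → j ≤ n → laplacian√2-p j ≡ embed (ρp j))
      (solves-q : ∀ j → j ≤ n → laplacian√2-q j ≡ embed (ρq j))
      (solves-u : ∀ j → j < n → laplacian√2-u j ≡ embed (ρu j))
      (solves-v : ∀ j → j < n → laplacian√2-v j ≡ embed (ρv j)) where

      realPart : V n → ℚ
      realPart = component re

      laplacian-realPart : ∀ w → laplacian n realPart w ≡ fromSequences n ρp ρq ρu ρv w
      laplacian-realPart (p k) =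
        trans (laplacian-component-p re refl (λ _ _ → refl) k) (cong re (solves-p (toℕ k) (FinP.toℕ≤pred[n] k)))
      laplacian-realPart (q k) =
        trans (laplacian-component-q re refl (λ _ _ → refl) k) (cong re (solves-q (toℕ k) (FinP.toℕ≤pred[n] k)))
      laplacian-realPart (u k) = trans (laplacian-u n _ _ _ _ k) (cong re (solves-u (toℕ k) (FinP.toℕ<n k)))
      laplacian-realPart (v k) = trans (laplacian-v n _ _ _ _ k) (cong re (solves-v (toℕ k) (FinP.toℕ<n k)))

      imaginaryPart-harmonic : ∀ w → laplacian n (component im) w ≡ 0ℚ
      imaginaryPart-harmonic (p k) =
        trans (laplacian-component-p im refl (λ _ _ → refl) k) (cong im (solves-p (toℕ k) (FinP.toℕ≤pred[n] k)))
      imaginaryPart-harmonic (q k) =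
        trans (laplacian-component-q im refl (λ _ _ → refl) k) (cong im (solves-q (toℕ k) (FinP.toℕ≤pred[n] k)))
      imaginaryPart-harmonic (u k) = trans (laplacian-u n _ _ _ _ k) (cong im (solves-u (toℕ k) (FinP.toℕ<n k)))
      imaginaryPart-harmonic (v k) = trans (laplacian-v n _ _ _ _ k) (cong im (solves-v (toℕ k) (FinP.toℕ<n k)))

      realPart-difference : ∀ a b → embed (realPart a - realPart b) ≡ X a ⊖ X b
      realPart-difference a b = cong₂ _⊹_ (cong₂ _-_ (re-X a) (re-X b))
        (sym (trans (cong₂ _-_ (sym (im-X a)) (sym (im-X b)))
          (p≡q⇒p-q≡0 (harmonic⇒constant n (component im) imaginaryPart-harmonic a b))))
        where
        re-X : ∀ w → component re w ≡ re (X w)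
        re-X (p k) = refl
        re-X (q k) = refl
        re-X (u k) = refl
        re-X (v k) = refl
        im-X : ∀ w → component im w ≡ im (X w)
        im-X (p k) = refl
        im-X (q k) = refl
        im-X (u k) = refl
        im-X (v k) = refl

module Antisymmetric where

  open import Defs
  open SqrtTwo
  open Alpha
  open Laplacian
  open Resistance
  open import Data.Nat using (ℕ; zero; suc; _+_; _*_; _∸_; _≤_; _<_; s≤s; z≤n; _≤ᵇ_; _≡ᵇ_; less; equal; greater; compare)
  import Data.Nat.Properties as ℕP
  open import Data.Fin using (Fin; toℕ) renaming (zero to fz; suc to fs)
  import Data.Fin as Fin
  import Data.Fin.Properties as FinP
  open import Data.Rational using (ℚ; 0ℚ; ½) renaming (_-_ to _-q_)
  open import Data.Bool using (true; false; if_then_else_; T)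
  open import Data.Unit using (tt)
  open import Data.Sum using (inj₁; inj₂)
  open import Data.Product using (_,_)
  open import Data.List using (_∷_; [])
  open import Relation.Nullary using (does)
  open import Relation.Binary.PropositionalEquality
  open import Tactic.RingSolver using (solve)

  half : ℚ√2
  half = ½ ⊹ 0ℚ

  κ : ℚ√2
  κ = (one ⊕ one) ⊗ inv (one ⊖ α ⊗ α)

  -- (Lx)(p j) when x (p j) = b = - x (q j) and u (j - 1), u j carry the means of their p-neighbours a, b and b, c;
  -- a missing neighbour at either end of the chain acts as a mirror image.
  balance : ℚ√2 → ℚ√2 → ℚ√2 → ℚ√2
  balance a b c = (one ⊕ one ⊕ one) ⊗ b ⊖ half ⊗ (a ⊕ c)

  -- endCorrection (α ^ j) = 1 + α ^ (2 j + 1).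
  endCorrection : ℚ√2 → ℚ√2
  endCorrection x = one ⊕ α ⊗ (x ⊗ x)

  -- The ring solver does not unfold definitions, so below balance and endCorrection are repeated as
  -- let-bound λs, which elaboration substitutes away; the statements agree definitionally.
  recurrence-left-at0 : ∀ c T F →
    let bal = λ a b c → (one ⊕ one ⊕ one) ⊗ b ⊖ half ⊗ (a ⊕ c) ; cf = λ x → one ⊕ α ⊗ (x ⊗ x) in
    bal (c ⊗ (α ⊗ (α ⊗ T)) ⊗ cf one ⊗ F) (c ⊗ (α ⊗ (α ⊗ T)) ⊗ cf one ⊗ F) (c ⊗ (α ⊗ T) ⊗ cf (α ⊗ one) ⊗ F) ≡ 0ℚ√2
  recurrence-left-at0 c T F = solve (c ∷ T ∷ F ∷ []) ℚ√2-ring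

  recurrence-left : ∀ c T X F →
    let bal = λ a b c → (one ⊕ one ⊕ one) ⊗ b ⊖ half ⊗ (a ⊕ c) ; cf = λ x → one ⊕ α ⊗ (x ⊗ x) in
    bal (c ⊗ (α ⊗ (α ⊗ (α ⊗ T))) ⊗ cf X ⊗ F) (c ⊗ (α ⊗ (α ⊗ T)) ⊗ cf (α ⊗ X) ⊗ F) (c ⊗ (α ⊗ T) ⊗ cf (α ⊗ (α ⊗ X)) ⊗ F)
      ≡ 0ℚ√2
  recurrence-left c T X F = solve (c ∷ T ∷ X ∷ F ∷ []) ℚ√2-ring

  recurrence-right : ∀ c S F R →
    let bal = λ a b c → (one ⊕ one ⊕ one) ⊗ b ⊖ half ⊗ (a ⊕ c) ; cf = λ x → one ⊕ α ⊗ (x ⊗ x) in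
    bal (c ⊗ (α ⊗ S) ⊗ F ⊗ cf (α ⊗ (α ⊗ R))) (c ⊗ (α ⊗ (α ⊗ S)) ⊗ F ⊗ cf (α ⊗ R)) (c ⊗ (α ⊗ (α ⊗ (α ⊗ S))) ⊗ F ⊗ cf R)
      ≡ 0ℚ√2
  recurrence-right c S F R = solve (c ∷ S ∷ F ∷ R ∷ []) ℚ√2-ring

  recurrence-right-atEnd : ∀ c S F →
    let bal = λ a b c → (one ⊕ one ⊕ one) ⊗ b ⊖ half ⊗ (a ⊕ c) ; cf = λ x → one ⊕ α ⊗ (x ⊗ x) in
    bal (c ⊗ (α ⊗ S) ⊗ F ⊗ cf (α ⊗ one)) (c ⊗ (α ⊗ (α ⊗ S)) ⊗ F ⊗ cf one) (c ⊗ (α ⊗ (α ⊗ S)) ⊗ F ⊗ cf one) ≡ 0ℚ√2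
  recurrence-right-atEnd c S F = solve (c ∷ S ∷ F ∷ []) ℚ√2-ring

  jump-at0 : ∀ I c M → c ≡ κ ⊗ I →
    let bal = λ a b c → (one ⊕ one ⊕ one) ⊗ b ⊖ half ⊗ (a ⊕ c) ; cf = λ x → one ⊕ α ⊗ (x ⊗ x) in
    bal (c ⊗ (α ⊗ one) ⊗ cf one ⊗ cf (α ⊗ M)) (c ⊗ (α ⊗ one) ⊗ cf one ⊗ cf (α ⊗ M)) (c ⊗ (α ⊗ (α ⊗ one)) ⊗ cf one ⊗ cf M)
      ≡ (one ⊖ α ⊗ α ⊗ ((one ⊗ one) ⊗ ((α ⊗ M) ⊗ (α ⊗ M)))) ⊗ I
  jump-at0 I .(κ ⊗ I) M refl = solve (I ∷ M ∷ []) ℚ√2-ring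

  jump : ∀ I c X M → c ≡ κ ⊗ I →
    let bal = λ a b c → (one ⊕ one ⊕ one) ⊗ b ⊖ half ⊗ (a ⊕ c) ; cf = λ x → one ⊕ α ⊗ (x ⊗ x) in
    bal (c ⊗ (α ⊗ (α ⊗ one)) ⊗ cf X ⊗ cf (α ⊗ M)) (c ⊗ (α ⊗ one) ⊗ cf (α ⊗ X) ⊗ cf (α ⊗ M))
        (c ⊗ (α ⊗ (α ⊗ one)) ⊗ cf (α ⊗ X) ⊗ cf M)
      ≡ (one ⊖ α ⊗ α ⊗ (((α ⊗ X) ⊗ (α ⊗ X)) ⊗ ((α ⊗ M) ⊗ (α ⊗ M)))) ⊗ I
  jump I .(κ ⊗ I) X M refl = solve (I ∷ X ∷ M ∷ []) ℚ√2-ring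

  jump-atEnd : ∀ I c X → c ≡ κ ⊗ I →
    let bal = λ a b c → (one ⊕ one ⊕ one) ⊗ b ⊖ half ⊗ (a ⊕ c) ; cf = λ x → one ⊕ α ⊗ (x ⊗ x) in
    bal (c ⊗ (α ⊗ (α ⊗ one)) ⊗ cf X ⊗ cf one) (c ⊗ (α ⊗ one) ⊗ cf (α ⊗ X) ⊗ cf one) (c ⊗ (α ⊗ one) ⊗ cf (α ⊗ X) ⊗ cf one)
      ≡ (one ⊖ α ⊗ α ⊗ (((α ⊗ X) ⊗ (α ⊗ X)) ⊗ (one ⊗ one))) ⊗ I
  jump-atEnd I .(κ ⊗ I) X refl = solve (I ∷ X ∷ []) ℚ√2-ring

  Ω Ω⁻¹ : ℕ → ℚ√2
  Ω n = one ⊖ α ^ (2 * n + 2)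
  Ω⁻¹ n = inv (Ω n)

  opaque
    scale : ℕ → ℚ√2
    scale n = κ ⊗ Ω⁻¹ n

  opaque
    unfolding scale
    scale-def : ∀ n → scale n ≡ κ ⊗ Ω⁻¹ n
    scale-def n = refl

  -- The response to a unit source at rung K (with m = n - K). Away from K it solves d (j - 1) + d (j + 1) = 6 d j,
  -- as α² - 6 α + 1 = 0; the end corrections give the mirror conditions at 0 and n, and scale = κ / Ω n the unit jump.
  greenLeft : ℕ → ℕ → ℕ → ℕ → ℚ√2
  greenLeft n K m j = scale n ⊗ α ^ suc (K ∸ j) ⊗ endCorrection (α ^ j) ⊗ endCorrection (α ^ m)
  greenRight : ℕ → ℕ → ℕ → ℚ√2
  greenRight n K j = scale n ⊗ α ^ suc (j ∸ K) ⊗ endCorrection (α ^ K) ⊗ endCorrection (α ^ (n ∸ j))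
  opaque
    green : ℕ → ℕ → ℕ → ℕ → ℚ√2
    green n K m j = if j ≤ᵇ K then greenLeft n K m j else greenRight n K j

  qRow uRow vRow : (ℕ → ℚ√2) → ℕ → ℚ√2
  qRow d j = ⊖1 (d j)
  uRow d j = half ⊗ (d j ⊕ d (suc j))
  vRow d j = ⊖1 (uRow d j)

  antisym-p antisym-q : ℕ → (ℕ → ℚ√2) → ℕ → ℚ√2
  antisym-p n d = ℚ√2-Laplacian.laplacian√2-p n d (qRow d) (uRow d) (vRow d)
  antisym-q n d = ℚ√2-Laplacian.laplacian√2-q n d (qRow d) (uRow d) (vRow d)

  antisym-p-at0 : ∀ n d → 0 < n → antisym-p n d 0 ≡ balance (d 0) (d 0) (d 1)
  antisym-p-at0 (suc n) d _ = mirror (d 0) (d 1)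
    where
    mirror : ∀ b c → (b ⊖ ⊖1 b) ⊕ ((b ⊖ half ⊗ (b ⊕ c)) ⊕ (0ℚ√2 ⊕ 0ℚ√2)) ≡ (one ⊕ one ⊕ one) ⊗ b ⊖ half ⊗ (b ⊕ c)
    mirror b c = solve (b ∷ c ∷ []) ℚ√2-ring

  antisym-p-interior : ∀ n d j → suc j < n → antisym-p n d (suc j) ≡ balance (d j) (d (suc j)) (d (suc (suc j)))
  antisym-p-interior n d j j+1<n = trans
    (cong (λ z → (d (suc j) ⊖ ⊖1 (d (suc j))) ⊕ (z ⊕ ((d (suc j) ⊖ uRow d j) ⊕ 0ℚ√2)))
          (rightEdge-< 0ℚ√2 n (suc j) (λ i → d i ⊖ uRow d i) j+1<n))
    (interior (d j) (d (suc j)) (d (suc (suc j))))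
    where
    interior : ∀ a b c → (b ⊖ ⊖1 b) ⊕ ((b ⊖ half ⊗ (b ⊕ c)) ⊕ ((b ⊖ half ⊗ (a ⊕ b)) ⊕ 0ℚ√2))
                       ≡ (one ⊕ one ⊕ one) ⊗ b ⊖ half ⊗ (a ⊕ c)
    interior a b c = solve (a ∷ b ∷ c ∷ []) ℚ√2-ring

  antisym-p-atEnd : ∀ n d j → suc j ≡ n → antisym-p n d (suc j) ≡ balance (d j) (d (suc j)) (d (suc j))
  antisym-p-atEnd .(suc j) d j refl = trans
    (cong (λ z → (d (suc j) ⊖ ⊖1 (d (suc j))) ⊕ (z ⊕ ((d (suc j) ⊖ uRow d j) ⊕ 0ℚ√2)))
          (rightEdge-n 0ℚ√2 (suc j) (λ i → d i ⊖ uRow d i)))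
    (mirror (d j) (d (suc j)))
    where
    mirror : ∀ a b → (b ⊖ ⊖1 b) ⊕ (0ℚ√2 ⊕ ((b ⊖ half ⊗ (a ⊕ b)) ⊕ 0ℚ√2)) ≡ (one ⊕ one ⊕ one) ⊗ b ⊖ half ⊗ (a ⊕ b)
    mirror a b = solve (a ∷ b ∷ []) ℚ√2-ring

  greenLeft-form : ∀ n K m j e → j + e ≡ K → greenLeft n K m j ≡ scale n ⊗ α ^ suc e ⊗ endCorrection (α ^ j) ⊗ endCorrection (α ^ m)
  greenLeft-form n K m j e h = cong (λ z → scale n ⊗ α ^ suc z ⊗ endCorrection (α ^ j) ⊗ endCorrection (α ^ m))
    (trans (cong (_∸ j) (sym h)) (ℕP.m+n∸m≡n j e))

  greenRight-form : ∀ n K j e r → K + e ≡ j → j + r ≡ n → greenRight n K j ≡ scale n ⊗ α ^ suc e ⊗ endCorrection (α ^ K) ⊗ endCorrection (α ^ r)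
  greenRight-form n K j e r h1 h2 = cong₂ (λ z w → scale n ⊗ α ^ suc z ⊗ endCorrection (α ^ K) ⊗ endCorrection (α ^ w))
    (trans (cong (_∸ K) (sym h1)) (ℕP.m+n∸m≡n K e))
    (trans (cong (_∸ j) (sym h2)) (ℕP.m+n∸m≡n j r))

  greenLeft≡greenRight : ∀ n K m → K + m ≡ n → greenLeft n K m K ≡ greenRight n K K
  greenLeft≡greenRight n K m e = cong (λ z → scale n ⊗ α ^ suc (K ∸ K) ⊗ endCorrection (α ^ K) ⊗ endCorrection (α ^ z))
    (sym (trans (cong (_∸ K) (sym e)) (ℕP.m+n∸m≡n K m)))

  opaque
    unfolding green
    green-left : ∀ n K m j → j ≤ K → green n K m j ≡ greenLeft n K m j
    green-left n K m j h with j ≤ᵇ K | ℕP.≤⇒≤ᵇ h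
    ... | true | _ = refl

    green-right : ∀ n K m j → K + m ≡ n → K ≤ j → green n K m j ≡ greenRight n K j
    green-right n K m j e h with j ≤ᵇ K in equal
    ... | false = refl
    ... | true = subst (λ z → greenLeft n K m z ≡ greenRight n K z) (sym jK) (greenLeft≡greenRight n K m e)
      where
      jK : j ≡ K
      jK = ℕP.≤-antisym (ℕP.≤ᵇ⇒≤ j K (subst T (sym equal) tt)) h

  ^-double : ∀ x n → x ^ (2 * n) ≡ x ^ n ⊗ x ^ n
  ^-double x n = trans (^-+ x n (n + 0)) (cong (λ z → x ^ n ⊗ x ^ z) (ℕP.+-identityʳ n))

  Ω-factor : ∀ n K m → K + m ≡ n → Ω n ≡ one ⊖ α ⊗ α ⊗ ((α ^ K ⊗ α ^ K) ⊗ (α ^ m ⊗ α ^ m))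
  Ω-factor n K m e = trans (cong (λ z → one ⊖ z) (trans (^-+ α (2 * n) 2) (cong (_⊗ (α ^ 2))
       (trans (^-double α n) (cong (λ z → z ⊗ z) (trans (cong (α ^_) (sym e)) (^-+ α K m)))))))
    (regroup (α ^ K) (α ^ m))
    where
    regroup : ∀ A B → one ⊖ ((A ⊗ B) ⊗ (A ⊗ B)) ⊗ (α ⊗ (α ⊗ one)) ≡ one ⊖ α ⊗ α ⊗ ((A ⊗ A) ⊗ (B ⊗ B))
    regroup A B = solve (A ∷ B ∷ []) ℚ√2-ring

  norm[Ω]≢0 : ∀ n → norm (one ⊖ α ^ (2 * n + 2)) ≢ 0ℚ
  norm[Ω]≢0 n h = norm[1-α^suc]≢0 (2 * n + 1) (trans (cong (λ z → norm (one ⊖ α ^ z)) (sym (ℕP.+-suc (2 * n) 1))) h)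

  Ω⊗Ω⁻¹ : ∀ n → Ω n ⊗ Ω⁻¹ n ≡ one
  Ω⊗Ω⁻¹ n = ⊗-inverseʳ (Ω n) (norm[Ω]≢0 n)

  ≡ᵇ-less : ∀ j t → (j ≡ᵇ suc (j + t)) ≡ false
  ≡ᵇ-less zero t = refl
  ≡ᵇ-less (suc j) t = ≡ᵇ-less j t

  ≡ᵇ-greater : ∀ K s → (suc (K + s) ≡ᵇ K) ≡ false
  ≡ᵇ-greater zero s = refl
  ≡ᵇ-greater (suc K) s = ≡ᵇ-greater K s

  ≡ᵇ-refl : ∀ K → (K ≡ᵇ K) ≡ true
  ≡ᵇ-refl zero = refl
  ≡ᵇ-refl (suc K) = ≡ᵇ-refl K

  sourceP : ℕ → ℕ → ℚ
  sourceP K j = indicator (j ≡ᵇ K) -q 0ℚ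

  antisym-p-left-at0 : ∀ n t m → suc t + m ≡ n → antisym-p n (green n (suc t) m) 0 ≡ embed (sourceP (suc t) 0)
  antisym-p-left-at0 n t m e =
    trans (antisym-p-at0 n (green n K m) (subst (0 <_) e (s≤s z≤n)))
    (trans (cong₂ (λ a c → balance a a c) (trans (green-left n K m 0 z≤n) (greenLeft-form n K m 0 (suc t) refl))
                     (trans (green-left n K m 1 (s≤s z≤n)) (greenLeft-form n K m 1 t refl)))
           (recurrence-left-at0 (scale n) (α ^ t) (endCorrection (α ^ m))))
    where
    K = suc t

  antisym-p-left-interior : ∀ n j0 t m → suc (suc (j0 + t)) + m ≡ n →
    antisym-p n (green n (suc (suc (j0 + t))) m) (suc j0) ≡ embed (sourceP (suc (suc (j0 + t))) (suc j0))
  antisym-p-left-interior n j0 t m e =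
    trans (antisym-p-interior n (green n K m) j0 j<n)
    (trans (cong₃ balance (trans (green-left n K m j0 (ℕP.≤-trans (ℕP.m≤m+n j0 t) (ℕP.≤-trans (ℕP.n≤1+n _) (ℕP.n≤1+n _))))
                            (greenLeft-form n K m j0 (suc (suc t)) (trans (ℕP.+-suc j0 (suc t)) (cong suc (ℕP.+-suc j0 t)))))
                     (trans (green-left n K m (suc j0) (s≤s (ℕP.≤-trans (ℕP.m≤m+n j0 t) (ℕP.n≤1+n _))))
                            (greenLeft-form n K m (suc j0) (suc t) (cong suc (ℕP.+-suc j0 t))))
                     (trans (green-left n K m (suc (suc j0)) (s≤s (s≤s (ℕP.m≤m+n j0 t))))
                            (greenLeft-form n K m (suc (suc j0)) t refl)))
     (trans (recurrence-left (scale n) (α ^ t) (α ^ j0) (endCorrection (α ^ m)))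
            (cong (λ b → embed (indicator b -q 0ℚ)) (sym (≡ᵇ-less (suc j0) t)))))
    where
    K = suc (suc (j0 + t))
    j<n : suc j0 < n
    j<n = ℕP.<-≤-trans (s≤s (s≤s (ℕP.m≤m+n j0 t))) (subst (K ≤_) e (ℕP.m≤m+n K m))

  one≡sourceP : ∀ K → one ≡ embed (sourceP K K)
  one≡sourceP K = cong (λ b → embed (indicator b -q 0ℚ)) (sym (≡ᵇ-refl K))

  antisym-p-source : ∀ n K m → K + m ≡ n → 1 ≤ n → antisym-p n (green n K m) K ≡ embed (sourceP K K)
  antisym-p-source .0 zero zero refl ()
  antisym-p-source n zero (suc m') e 1≤n =
    trans (antisym-p-at0 n (green n 0 (suc m')) (subst (0 <_) e (s≤s z≤n)))
    (trans (cong₂ (λ a c → balance a a c) (trans (green-left n 0 (suc m') 0 z≤n) (greenLeft-form n 0 (suc m') 0 0 refl))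
                     (trans (green-right n 0 (suc m') 1 e z≤n) (greenRight-form n 0 1 1 m' refl e)))
    (trans (jump-at0 (Ω⁻¹ n) (scale n) (α ^ m') (scale-def n))
    (trans (cong (_⊗ Ω⁻¹ n) (sym (Ω-factor n 0 (suc m') e))) (trans (Ω⊗Ω⁻¹ n) (one≡sourceP 0)))))
  antisym-p-source n (suc K0) zero e 1≤n =
    trans (antisym-p-atEnd n (green n K 0) K0 eN)
    (trans (cong₂ (λ a b → balance a b b) (trans (green-left n K 0 K0 (ℕP.n≤1+n K0)) (greenLeft-form n K 0 K0 1 (trans (ℕP.+-suc K0 0) (cong suc (ℕP.+-identityʳ K0)))))
                     (trans (green-left n K 0 K ℕP.≤-refl) (greenLeft-form n K 0 K 0 (ℕP.+-identityʳ K))))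
    (trans (jump-atEnd (Ω⁻¹ n) (scale n) (α ^ K0) (scale-def n))
    (trans (cong (_⊗ Ω⁻¹ n) (sym (Ω-factor n K 0 e))) (trans (Ω⊗Ω⁻¹ n) (one≡sourceP K)))))
    where
    K = suc K0
    eN : suc K0 ≡ n
    eN = trans (sym (ℕP.+-identityʳ (suc K0))) e
  antisym-p-source n (suc K0) (suc m') e 1≤n =
    trans (antisym-p-interior n (green n K m) K0 j<n)
    (trans (cong₃ balance (trans (green-left n K m K0 (ℕP.n≤1+n K0)) (greenLeft-form n K m K0 1 (trans (ℕP.+-suc K0 0) (cong suc (ℕP.+-identityʳ K0)))))
                     (trans (green-left n K m K ℕP.≤-refl) (greenLeft-form n K m K 0 (ℕP.+-identityʳ K)))
                     (trans (green-right n K m (suc K) e (ℕP.n≤1+n K))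
                            (greenRight-form n K (suc K) 1 m' (trans (ℕP.+-suc K 0) (cong suc (ℕP.+-identityʳ K)))
                                   (trans (cong suc (sym (ℕP.+-suc K0 m'))) e))))
    (trans (jump (Ω⁻¹ n) (scale n) (α ^ K0) (α ^ m') (scale-def n))
    (trans (cong (_⊗ Ω⁻¹ n) (sym (Ω-factor n K m e))) (trans (Ω⊗Ω⁻¹ n) (one≡sourceP K)))))
    where
    K = suc K0
    m = suc m'
    j<n : suc K0 < n
    j<n = subst (suc K0 <_) e (ℕP.m<m+n (suc K0) (s≤s z≤n))

  antisym-p-right : ∀ n K m s → K + m ≡ n → suc (K + s) ≤ n →
    antisym-p n (green n K m) (suc (K + s)) ≡ embed (sourceP K (suc (K + s)))
  antisym-p-right n K m s e jn with ℕP.m≤n⇒m<n∨m≡n jn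
  ... | inj₁ jl = caseC1 (ℕP.m≤n⇒∃[o]m+o≡n jl)
    where
    caseC1 : _ → antisym-p n (green n K m) (suc (K + s)) ≡ embed (sourceP K (suc (K + s)))
    caseC1 (r0 , h) =
        trans (antisym-p-interior n (green n K m) (K + s) jl)
        (trans (cong₃ balance (trans (green-right n K m (K + s) e (ℕP.m≤m+n K s))
                                (greenRight-form n K (K + s) s (suc (suc r0)) refl
                                   (trans (ℕP.+-suc (K + s) (suc r0)) (trans (cong suc (ℕP.+-suc (K + s) r0)) h))))
                         (trans (green-right n K m (suc (K + s)) e (ℕP.≤-trans (ℕP.m≤m+n K s) (ℕP.n≤1+n _)))
                                (greenRight-form n K (suc (K + s)) (suc s) (suc r0) (ℕP.+-suc K s) (trans (cong suc (ℕP.+-suc (K + s) r0)) h)))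
                         (trans (green-right n K m (suc (suc (K + s))) e (ℕP.≤-trans (ℕP.m≤m+n K s) (ℕP.≤-trans (ℕP.n≤1+n _) (ℕP.n≤1+n _))))
                                (greenRight-form n K (suc (suc (K + s))) (suc (suc s)) r0
                                   (trans (ℕP.+-suc K (suc s)) (cong suc (ℕP.+-suc K s))) h)))
        (trans (recurrence-right (scale n) (α ^ s) (endCorrection (α ^ K)) (α ^ r0))
               (cong (λ b → embed (indicator b -q 0ℚ)) (sym (≡ᵇ-greater K s)))))
  ... | inj₂ eqn =
    trans (antisym-p-atEnd n (green n K m) (K + s) eqn)
    (trans (cong₂ (λ a b → balance a b b) (trans (green-right n K m (K + s) e (ℕP.m≤m+n K s))
                            (greenRight-form n K (K + s) s 1 refl (trans (ℕP.+-suc (K + s) 0) (trans (cong suc (ℕP.+-identityʳ _)) eqn))))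
                     (trans (green-right n K m (suc (K + s)) e (ℕP.≤-trans (ℕP.m≤m+n K s) (ℕP.n≤1+n _)))
                            (greenRight-form n K (suc (K + s)) (suc s) 0 (ℕP.+-suc K s) (trans (ℕP.+-identityʳ _) eqn))))
    (trans (recurrence-right-atEnd (scale n) (α ^ s) (endCorrection (α ^ K)))
           (cong (λ b → embed (indicator b -q 0ℚ)) (sym (≡ᵇ-greater K s)))))

  antisym-p-solves : ∀ n K m → K + m ≡ n → 1 ≤ n → ∀ j → j ≤ n → antisym-p n (green n K m) j ≡ embed (sourceP K j)
  antisym-p-solves n K m K+m≡n 1≤n j jn with compare j K
  ... | less zero t = antisym-p-left-at0 n t m K+m≡n
  ... | less (suc j0) t = antisym-p-left-interior n j0 t m K+m≡n
  ... | equal j = antisym-p-source n j m K+m≡n 1≤n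
  ... | greater K s = antisym-p-right n K m s K+m≡n jn

  ⊖1-⊖ : ∀ a b → ⊖1 (a ⊖ b) ≡ ⊖1 a ⊖ ⊖1 b
  ⊖1-⊖ a b = solve (a ∷ b ∷ []) ℚ√2-ring

  antisym-q-identity : ∀ b F Pr → (⊖1 b ⊖ b) ⊕ (0ℚ√2 ⊕ (0ℚ√2 ⊕ (⊖1 F ⊕ ⊖1 Pr))) ≡ ⊖1 ((b ⊖ ⊖1 b) ⊕ (F ⊕ (Pr ⊕ 0ℚ√2)))
  antisym-q-identity b F Pr = solve (b ∷ F ∷ Pr ∷ []) ℚ√2-ring

  uRow-balanced : ∀ a b → 0ℚ√2 ⊕ ((half ⊗ (a ⊕ b) ⊖ a) ⊕ ((half ⊗ (a ⊕ b) ⊖ b) ⊕ (0ℚ√2 ⊕ 0ℚ√2))) ≡ 0ℚ√2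
  uRow-balanced a b = solve (a ∷ b ∷ []) ℚ√2-ring

  vRow-balanced : ∀ a b → 0ℚ√2 ⊕ (0ℚ√2 ⊕ (0ℚ√2 ⊕ ((⊖1 (half ⊗ (a ⊕ b)) ⊖ ⊖1 a) ⊕ (⊖1 (half ⊗ (a ⊕ b)) ⊖ ⊖1 b)))) ≡ 0ℚ√2
  vRow-balanced a b = solve (a ∷ b ∷ []) ℚ√2-ring

  antisym-q≡⊖antisym-p : ∀ n d j → antisym-q n d j ≡ ⊖1 (antisym-p n d j)
  antisym-q≡⊖antisym-p n d j = trans (cong₂ (λ x y → (⊖1 (d j) ⊖ d j) ⊕ (0ℚ√2 ⊕ (0ℚ√2 ⊕ (x ⊕ y)))) rightEdge-q leftEdge-q)
                     (antisym-q-identity (d j) (rightEdge 0ℚ√2 n j (λ i → d i ⊖ uRow d i)) (leftEdge 0ℚ√2 (λ i → d (suc i) ⊖ uRow d i) j))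
    where
    rightEdge-q : rightEdge 0ℚ√2 n j (λ i → qRow d i ⊖ vRow d i) ≡ ⊖1 (rightEdge 0ℚ√2 n j (λ i → d i ⊖ uRow d i))
    rightEdge-q = sym (rightEdge-map ⊖1 refl n j (λ i → d i ⊖ uRow d i) (λ i → qRow d i ⊖ vRow d i) (λ i → ⊖1-⊖ (d i) (uRow d i)))
    leftEdge-q : leftEdge 0ℚ√2 (λ i → qRow d (suc i) ⊖ vRow d i) j ≡ ⊖1 (leftEdge 0ℚ√2 (λ i → d (suc i) ⊖ uRow d i) j)
    leftEdge-q = sym (leftEdge-map ⊖1 refl (λ i → d (suc i) ⊖ uRow d i) (λ i → qRow d (suc i) ⊖ vRow d i) (λ i → ⊖1-⊖ (d (suc i)) (uRow d i)) j)

  sourceQ : ℕ → ℕ → ℚ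
  sourceQ K j = 0ℚ -q indicator (j ≡ᵇ K)

  ⊖1-sourceP : ∀ b → ⊖1 (embed (indicator b -q 0ℚ)) ≡ embed (0ℚ -q indicator b)
  ⊖1-sourceP true = refl
  ⊖1-sourceP false = refl

  does-≟≡≡ᵇ : ∀ {m} (a b : Fin m) → does (a Fin.≟ b) ≡ (toℕ a ≡ᵇ toℕ b)
  does-≟≡≡ᵇ fz fz = refl
  does-≟≡≡ᵇ fz (fs b) = refl
  does-≟≡≡ᵇ (fs a) fz = refl
  does-≟≡≡ᵇ (fs a) (fs b) = does-≟≡≡ᵇ a b

  module GreenSolution (n : ℕ) (1≤n : 1 ≤ n) (i : Fin (suc n)) where
    K m : ℕ
    K = toℕ i
    m = n ∸ K
    K+m≡n : K + m ≡ n
    K+m≡n = ℕP.m+[n∸m]≡n (FinP.toℕ≤pred[n] i)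
    greenRow : ℕ → ℚ√2
    greenRow = green n K m
    open ℚ√2-Laplacian n greenRow (qRow greenRow) (uRow greenRow) (vRow greenRow) public

    solves-p : ∀ j → j ≤ n → laplacian√2-p j ≡ embed (sourceP K j)
    solves-p = antisym-p-solves n K m K+m≡n 1≤n
    solves-q : ∀ j → j ≤ n → laplacian√2-q j ≡ embed (sourceQ K j)
    solves-q j h = trans (antisym-q≡⊖antisym-p n greenRow j) (trans (cong ⊖1 (antisym-p-solves n K m K+m≡n 1≤n j h)) (⊖1-sourceP (j ≡ᵇ K)))
    solves-u : ∀ j → j < n → laplacian√2-u j ≡ embed (0ℚ -q 0ℚ)
    solves-u j h = uRow-balanced (greenRow j) (greenRow (suc j))
    solves-v : ∀ j → j < n → laplacian√2-v j ≡ embed (0ℚ -q 0ℚ)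
    solves-v j h = vRow-balanced (greenRow j) (greenRow (suc j))

    open RationalSolution (sourceP K) (sourceQ K) (λ _ → 0ℚ -q 0ℚ) (λ _ → 0ℚ -q 0ℚ) solves-p solves-q solves-u solves-v public

    realPart-isPotential : IsPotential n (p i) (q i) realPart
    realPart-isPotential w = trans (laplacian-realPart w) (source≡δ w)
      where
      source≡δ : ∀ w → fromSequences n (sourceP K) (sourceQ K) (λ _ → 0ℚ -q 0ℚ) (λ _ → 0ℚ -q 0ℚ) w ≡ δ (p i) w -q δ (q i) w
      source≡δ (p k) = cong (λ b → indicator b -q 0ℚ) (sym (does-≟≡≡ᵇ k i))
      source≡δ (q k) = cong (λ b → 0ℚ -q indicator b) (sym (does-≟≡≡ᵇ k i))
      source≡δ (u k) = refl
      source≡δ (v k) = refl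

  norm[√2]≢0 : norm √2 ≢ 0ℚ
  norm[√2]≢0 ()

  inv[√2⊗Ω] : ∀ n → inv (√2 ⊗ (one ⊖ α ^ (2 * n + 2))) ≡ inv √2 ⊗ Ω⁻¹ n
  inv[√2⊗Ω] n = inv-⊗ √2 (Ω n) norm[√2]≢0 (norm[Ω]≢0 n)

  α^odd : ∀ k → α ^ (2 * k + 1) ≡ α ⊗ (α ^ k ⊗ α ^ k)
  α^odd k = trans (^-+ α (2 * k) 1) (trans (cong (_⊗ (α ^ 1)) (^-double α k)) (regroup (α ^ k)))
    where
    regroup : ∀ X → (X ⊗ X) ⊗ (α ⊗ one) ≡ α ⊗ (X ⊗ X)
    regroup X = solve (X ∷ []) ℚ√2-ring

  endCorrection-right : ∀ n K → one ⊕ α ^ (2 * n ∸ 2 * K + 1) ≡ endCorrection (α ^ (n ∸ K))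
  endCorrection-right n K = cong (one ⊕_) (trans (cong (λ z → α ^ (z + 1)) (sym (ℕP.*-distribˡ-∸ 2 n K))) (α^odd (n ∸ K)))

  endCorrection-left : ∀ K → one ⊕ α ^ (2 * K + 1) ≡ endCorrection (α ^ K)
  endCorrection-left K = cong (one ⊕_) (α^odd K)

  pq-difference-identity : ∀ I c A B → c ≡ κ ⊗ I → (c ⊗ α ^ suc 0 ⊗ A ⊗ B) ⊖ ⊖1 (c ⊗ α ^ suc 0 ⊗ A ⊗ B) ≡ (B ⊗ A) ⊗ (inv √2 ⊗ I)
  pq-difference-identity I .(κ ⊗ I) A B refl = identity I A B
    where
    identity : ∀ I A B → (κ ⊗ I ⊗ (α ⊗ one) ⊗ A ⊗ B) ⊖ ⊖1 (κ ⊗ I ⊗ (α ⊗ one) ⊗ A ⊗ B) ≡ (B ⊗ A) ⊗ (inv √2 ⊗ I)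
    identity I A B = solve (I ∷ A ∷ B ∷ []) ℚ√2-ring

  resistance-p-q : (n : ℕ) → 1 ≤ n → (i : Fin (suc n)) →
        ResistanceIs n (p i) (q i)
          (((one ⊕ α ^ (2 * n ∸ 2 * toℕ i + 1)) ⊗ (one ⊕ α ^ (2 * toℕ i + 1)))
            ⊘ (√2 ⊗ (one ⊖ α ^ (2 * n + 2))))
  resistance-p-q n 1≤n i = resistanceIs realPart realPart-isPotential (trans (realPart-difference (p i) (q i)) value)
    where
    open GreenSolution n 1≤n i
    greenRow-at-source : greenRow K ≡ scale n ⊗ α ^ suc 0 ⊗ endCorrection (α ^ K) ⊗ endCorrection (α ^ m)
    greenRow-at-source = trans (green-left n K m K ℕP.≤-refl) (greenLeft-form n K m K 0 (ℕP.+-identityʳ K))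
    value : greenRow K ⊖ ⊖1 (greenRow K) ≡ ((one ⊕ α ^ (2 * n ∸ 2 * K + 1)) ⊗ (one ⊕ α ^ (2 * K + 1))) ⊗ inv (√2 ⊗ (one ⊖ α ^ (2 * n + 2)))
    value = trans (cong (λ z → z ⊖ ⊖1 z) greenRow-at-source)
        (trans (pq-difference-identity (Ω⁻¹ n) (scale n) (endCorrection (α ^ K)) (endCorrection (α ^ m)) (scale-def n))
         (sym (cong₂ _⊗_ (cong₂ _⊗_ (endCorrection-right n K) (endCorrection-left K)) (inv[√2⊗Ω] n))))

module Symmetric where

  open import Defs
  open SqrtTwo using (ℚ-ring)
  open Laplacian
  open import Data.Nat using (ℕ; zero; suc; _≤_; _<_; _<ᵇ_; _≡ᵇ_) renaming (_+_ to _+ℕ_)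
  import Data.Nat.Properties as ℕP
  open import Data.Fin using (toℕ)
  open import Data.Rational using (ℚ; 0ℚ; 1ℚ; ½; _+_; _-_; _*_; -_)
  import Data.Rational.Properties as ℚP
  open import Data.Bool using (Bool; true; false; if_then_else_; T)
  open import Data.List using ([]; _∷_)
  open import Data.Unit using (tt)
  open import Data.Empty using (⊥-elim)
  open import Relation.Binary.PropositionalEquality
  open import Tactic.RingSolver using (solve)

  step : ℕ → ℕ → ℚ
  step t j = if t <ᵇ j then 1ℚ + 1ℚ else 0ℚ

  stepMid : ℕ → ℕ → ℚ
  stepMid t j = ½ * (step t j + step t (suc j))

  step-stepMid : ∀ t i → step t i - stepMid t i ≡ (if i ≡ᵇ t then - 1ℚ else 0ℚ)
  step-stepMid zero zero = refl
  step-stepMid zero (suc i) = refl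
  step-stepMid (suc t) zero = refl
  step-stepMid (suc t) (suc i) = step-stepMid t i

  step-suc-stepMid : ∀ t i → step t (suc i) - stepMid t i ≡ (if i ≡ᵇ t then 1ℚ else 0ℚ)
  step-suc-stepMid zero zero = refl
  step-suc-stepMid zero (suc i) = refl
  step-suc-stepMid (suc t) zero = refl
  step-suc-stepMid (suc t) (suc i) = step-suc-stepMid t i

  stepPotential : (n t : ℕ) → V n → ℚ
  stepPotential n t = fromSequences n (step t) (step t) (stepMid t) (stepMid t)

  module StepPotential (n t : ℕ) (t<n : t < n) where
    stepSource : V n → ℚ
    stepSource = fromSequences n (λ j → indicator (j ≡ᵇ suc t) - indicator (j ≡ᵇ t)) (λ j → indicator (j ≡ᵇ suc t) - indicator (j ≡ᵇ t)) (λ _ → 0ℚ) (λ _ → 0ℚ)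

    rightEdge-step : ∀ k → rightEdge 0ℚ n k (λ j → step t j - stepMid t j) ≡ (if k ≡ᵇ t then - 1ℚ else 0ℚ)
    rightEdge-step k = trans (rightEdge-cong 0ℚ n k _ _ (step-stepMid t)) (rightEdge-indicator (- 1ℚ) n k t t<n)
    leftEdge-step : ∀ k → leftEdge 0ℚ (λ j → step t (suc j) - stepMid t j) k ≡ (if k ≡ᵇ suc t then 1ℚ else 0ℚ)
    leftEdge-step k = trans (leftEdge-cong 0ℚ k _ _ (step-suc-stepMid t)) (leftEdge-indicator 1ℚ k t)

    balance-pq : ∀ (s : ℚ) (b c : Bool) →
      (s - s) + ((if b then - 1ℚ else 0ℚ) + ((if c then 1ℚ else 0ℚ) + 0ℚ)) ≡ indicator c - indicator b
    balance-pq s b c = trans (cong (_+ _) (ℚP.+-inverseʳ s)) (closed b c)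
      where
      closed : ∀ b c → 0ℚ + ((if b then - 1ℚ else 0ℚ) + ((if c then 1ℚ else 0ℚ) + 0ℚ)) ≡ indicator c - indicator b
      closed true true = refl
      closed true false = refl
      closed false true = refl
      closed false false = refl

    rail-order : ∀ a b → 0ℚ + (0ℚ + (a + b)) ≡ a + (b + 0ℚ)
    rail-order a b = solve (a ∷ b ∷ []) ℚ-ring

    balance-u : ∀ (m s s' : ℚ) (b : Bool) → s - m ≡ (if b then - 1ℚ else 0ℚ) → s' - m ≡ (if b then 1ℚ else 0ℚ) →
           0ℚ + ((m - s) + ((m - s') + (0ℚ + 0ℚ))) ≡ 0ℚ
    balance-u m s s' b h₁ h₂ = trans (regroup m s s') (trans (cong₂ (λ x y → - (x + y)) h₁ h₂) (cancel b))
      where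
      regroup : ∀ m s s' → 0ℚ + ((m - s) + ((m - s') + (0ℚ + 0ℚ))) ≡ - ((s - m) + (s' - m))
      regroup m s s' = solve (m ∷ s ∷ s' ∷ []) ℚ-ring
      cancel : ∀ b → - ((if b then - 1ℚ else 0ℚ) + (if b then 1ℚ else 0ℚ)) ≡ 0ℚ
      cancel true = refl
      cancel false = refl

    balance-v : ∀ (m s s' : ℚ) (b : Bool) → s - m ≡ (if b then - 1ℚ else 0ℚ) → s' - m ≡ (if b then 1ℚ else 0ℚ) →
           0ℚ + (0ℚ + (0ℚ + ((m - s) + (m - s')))) ≡ 0ℚ
    balance-v m s s' b h₁ h₂ = trans (regroup m s s') (trans (cong₂ (λ x y → - (x + y)) h₁ h₂) (cancel b))
      where
      regroup : ∀ m s s' → 0ℚ + (0ℚ + (0ℚ + ((m - s) + (m - s')))) ≡ - ((s - m) + (s' - m))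
      regroup m s s' = solve (m ∷ s ∷ s' ∷ []) ℚ-ring
      cancel : ∀ b → - ((if b then - 1ℚ else 0ℚ) + (if b then 1ℚ else 0ℚ)) ≡ 0ℚ
      cancel true = refl
      cancel false = refl

    laplacian-stepPotential : ∀ w → laplacian n (stepPotential n t) w ≡ stepSource w
    laplacian-stepPotential (p k) = trans (laplacian-p n (step t) (step t) (stepMid t) (stepMid t) k)
      (trans (cong₂ (λ a b → (step t (toℕ k) - step t (toℕ k)) + (a + (b + 0ℚ))) (rightEdge-step (toℕ k)) (leftEdge-step (toℕ k)))
             (balance-pq (step t (toℕ k)) (toℕ k ≡ᵇ t) (toℕ k ≡ᵇ suc t)))
    laplacian-stepPotential (q k) = trans (laplacian-q n (step t) (step t) (stepMid t) (stepMid t) k)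
      (trans (cong₂ (λ a b → (step t (toℕ k) - step t (toℕ k)) + (0ℚ + (0ℚ + (a + b)))) (rightEdge-step (toℕ k)) (leftEdge-step (toℕ k)))
             (trans (cong ((step t (toℕ k) - step t (toℕ k)) +_) (rail-order (if toℕ k ≡ᵇ t then - 1ℚ else 0ℚ) _))
                    (balance-pq (step t (toℕ k)) (toℕ k ≡ᵇ t) (toℕ k ≡ᵇ suc t))))
    laplacian-stepPotential (u k) = trans (laplacian-u n (step t) (step t) (stepMid t) (stepMid t) k)
      (balance-u (stepMid t (toℕ k)) (step t (toℕ k)) (step t (suc (toℕ k))) (toℕ k ≡ᵇ t) (step-stepMid t (toℕ k)) (step-suc-stepMid t (toℕ k)))
    laplacian-stepPotential (v k) = trans (laplacian-v n (step t) (step t) (stepMid t) (stepMid t) k)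
      (balance-v (stepMid t (toℕ k)) (step t (toℕ k)) (step t (suc (toℕ k))) (toℕ k ≡ᵇ t) (step-stepMid t (toℕ k)) (step-suc-stepMid t (toℕ k)))

  rungSource : (n I : ℕ) → V n → ℚ
  rungSource n I = fromSequences n (λ j → indicator (j ≡ᵇ I)) (λ j → indicator (j ≡ᵇ I)) (λ _ → 0ℚ) (λ _ → 0ℚ)

  stepSource≡ : ∀ n t t<n w → StepPotential.stepSource n t t<n w ≡ rungSource n (suc t) w - rungSource n t w
  stepSource≡ n t t<n (p k) = refl
  stepSource≡ n t t<n (q k) = refl
  stepSource≡ n t t<n (u k) = refl
  stepSource≡ n t t<n (v k) = refl

  rampPotential : (n J : ℕ) → ℕ → V n → ℚ
  rampPotential n J zero = λ _ → 0ℚ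
  rampPotential n J (suc d) = λ w → 1ℚ * rampPotential n J d w + 1ℚ * stepPotential n (J +ℕ d) w

  laplacian-rampPotential : ∀ n J d → J +ℕ d ≤ n → ∀ w → laplacian n (rampPotential n J d) w ≡ rungSource n (J +ℕ d) w - rungSource n J w
  laplacian-rampPotential n J zero h w = trans (laplacian-0 n w) (sym (trans (cong (λ z → rungSource n z w - rungSource n J w) (ℕP.+-identityʳ J)) (ℚP.+-inverseʳ (rungSource n J w))))
  laplacian-rampPotential n J (suc d) h w = trans (laplacian-linear 1ℚ 1ℚ (rampPotential n J d) (stepPotential n (J +ℕ d)) w)
     (trans (cong₂ (λ a b → 1ℚ * a + 1ℚ * b) (laplacian-rampPotential n J d (ℕP.≤-trans (ℕP.+-monoʳ-≤ J (ℕP.n≤1+n d)) h) w)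
                   (trans (StepPotential.laplacian-stepPotential n (J +ℕ d) t<n w) (stepSource≡ n (J +ℕ d) t<n w)))
     (trans (telescope (rungSource n (J +ℕ d) w) (rungSource n J w) (rungSource n (suc (J +ℕ d)) w))
            (cong (λ z → rungSource n z w - rungSource n J w) (sym (ℕP.+-suc J d)))))
    where
    t<n : J +ℕ d < n
    t<n = subst (_≤ n) (ℕP.+-suc J d) h
    telescope : ∀ a b c → 1ℚ * (a - b) + 1ℚ * (c - a) ≡ c - b
    telescope a b c = solve (a ∷ b ∷ c ∷ []) ℚ-ring

  rampRow : ℕ → ℕ → ℕ → ℚ
  rampRow J zero j = 0ℚ
  rampRow J (suc d) j = 1ℚ * rampRow J d j + 1ℚ * step (J +ℕ d) j

  rampPotential-p : ∀ n J d k → rampPotential n J d (p k) ≡ rampRow J d (toℕ k)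
  rampPotential-p n J zero k = refl
  rampPotential-p n J (suc d) k = cong (λ z → 1ℚ * z + 1ℚ * step (J +ℕ d) (toℕ k)) (rampPotential-p n J d k)

  rampPotential-q : ∀ n J d k → rampPotential n J d (q k) ≡ rampRow J d (toℕ k)
  rampPotential-q n J zero k = refl
  rampPotential-q n J (suc d) k = cong (λ z → 1ℚ * z + 1ℚ * step (J +ℕ d) (toℕ k)) (rampPotential-q n J d k)

  step-below : ∀ t k → k ≤ t → step t k ≡ 0ℚ
  step-below t k h with t <ᵇ k in eq
  ... | false = refl
  ... | true = ⊥-elim (ℕP.<⇒≱ (ℕP.<ᵇ⇒< t k (subst T (sym eq) tt)) h)

  step-above : ∀ t k → t < k → step t k ≡ 1ℚ + 1ℚ
  step-above t k h with t <ᵇ k | ℕP.<⇒<ᵇ h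
  ... | true | _ = refl

  natℚ : ℕ → ℚ
  natℚ zero = 0ℚ
  natℚ (suc d) = 1ℚ + natℚ d

  rampRow-low : ∀ J d k → k ≤ J → rampRow J d k ≡ 0ℚ
  rampRow-low J zero k h = refl
  rampRow-low J (suc d) k h = trans (cong₂ (λ a b → 1ℚ * a + 1ℚ * b) (rampRow-low J d k h) (step-below (J +ℕ d) k (ℕP.≤-trans h (ℕP.m≤m+n J d)))) refl

  rampRow-high : ∀ J d k → J +ℕ d ≤ k → rampRow J d k ≡ natℚ d + natℚ d
  rampRow-high J zero k h = refl
  rampRow-high J (suc d) k h = trans (cong₂ (λ a b → 1ℚ * a + 1ℚ * b)
        (rampRow-high J d k (ℕP.≤-trans (ℕP.+-monoʳ-≤ J (ℕP.n≤1+n d)) h))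
        (step-above (J +ℕ d) k (subst (_≤ k) (ℕP.+-suc J d) h)))
     (regroup (natℚ d))
    where
    regroup : ∀ x → 1ℚ * (x + x) + 1ℚ * (1ℚ + 1ℚ) ≡ (1ℚ + x) + (1ℚ + x)
    regroup x = solve (x ∷ []) ℚ-ring

module ResistanceAlongRails where

  open import Defs
  open SqrtTwo
  open Alpha
  open Laplacian
  open Resistance
  open Antisymmetric
  open Symmetric
  open import Data.Nat using (ℕ; zero; suc; _∸_; _≤_) renaming (_+_ to _+n_; _*_ to _*n_)
  import Data.Nat.Properties as ℕP
  open import Data.Fin using (Fin; toℕ)
  open import Data.Rational using (ℚ; 0ℚ; ½; _+_; _-_; _*_; -_)
  import Data.Rational.Properties as ℚP
  open import Data.List using (_∷_; [])
  open import Relation.Binary.PropositionalEquality hiding (J)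
  open import Tactic.RingSolver using (solve)

  rungSource≡δ : ∀ n (i : Fin (suc n)) w → rungSource n (toℕ i) w ≡ δ (p i) w + δ (q i) w
  rungSource≡δ n i (p k) = trans (cong indicator (sym (does-≟≡≡ᵇ k i))) (sym (ℚP.+-identityʳ _))
  rungSource≡δ n i (q k) = trans (cong indicator (sym (does-≟≡≡ᵇ k i))) (sym (ℚP.+-identityˡ _))
  rungSource≡δ n i (u k) = refl
  rungSource≡δ n i (v k) = refl

  natℚ≡nat : ∀ d → embed (natℚ d) ≡ nat d
  natℚ≡nat zero = refl
  natℚ≡nat (suc d) = cong (one ⊕_) (natℚ≡nat d)

  pp-value-identity : ∀ I c X D M N AI AmJ InvE Aij A2j A2i → c ≡ κ ⊗ I → AI ≡ X ⊗ D → AmJ ≡ D ⊗ M →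
    InvE ≡ inv (nat 4 ⊗ √2) ⊗ I → Aij ≡ α ⊗ (D ⊗ (X ⊗ X)) → A2j ≡ α ⊗ (X ⊗ X) → A2i ≡ α ⊗ (M ⊗ M) →
    let cf = λ x → one ⊕ α ⊗ (x ⊗ x) in
    embed ½ ⊗ (N ⊕ N) ⊕ (embed ½ ⊗ ((c ⊗ (α ⊗ one) ⊗ cf AI ⊗ cf M) ⊖ (c ⊗ (α ⊗ D) ⊗ cf X ⊗ cf M))
         ⊕ embed (- ½) ⊗ ((c ⊗ (α ⊗ D) ⊗ cf X ⊗ cf M) ⊖ (c ⊗ (α ⊗ one) ⊗ cf X ⊗ cf AmJ)))
    ≡ N ⊕ (one ⊖ D) ⊗ InvE ⊗ (nat 2 ⊖ Aij ⊕ A2j ⊕ A2i ⊗ (one ⊖ D ⊖ nat 2 ⊗ Aij))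
  pp-value-identity I .(κ ⊗ I) X D M N .(X ⊗ D) .(D ⊗ M) .(inv (nat 4 ⊗ √2) ⊗ I) .(α ⊗ (D ⊗ (X ⊗ X)))
    .(α ⊗ (X ⊗ X)) .(α ⊗ (M ⊗ M)) refl refl refl refl refl refl refl = solve (I ∷ X ∷ D ∷ M ∷ N ∷ []) ℚ√2-ring

  qp-value-identity : ∀ I c X D M N AI AmJ InvE Aij A2j A2i → c ≡ κ ⊗ I → AI ≡ X ⊗ D → AmJ ≡ D ⊗ M →
    InvE ≡ inv (nat 4 ⊗ √2) ⊗ I → Aij ≡ α ⊗ (D ⊗ (X ⊗ X)) → A2j ≡ α ⊗ (X ⊗ X) → A2i ≡ α ⊗ (M ⊗ M) →
    let cf = λ x → one ⊕ α ⊗ (x ⊗ x) in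
    embed ½ ⊗ (N ⊕ N) ⊕ (embed (- ½) ⊗ (⊖1 (c ⊗ (α ⊗ one) ⊗ cf AI ⊗ cf M) ⊖ (c ⊗ (α ⊗ D) ⊗ cf X ⊗ cf M))
         ⊕ embed (- ½) ⊗ (⊖1 (c ⊗ (α ⊗ D) ⊗ cf X ⊗ cf M) ⊖ (c ⊗ (α ⊗ one) ⊗ cf X ⊗ cf AmJ)))
    ≡ N ⊕ (one ⊕ D) ⊗ InvE ⊗ (nat 2 ⊕ Aij ⊕ A2j ⊕ A2i ⊗ (one ⊕ D ⊕ nat 2 ⊗ Aij))
  qp-value-identity I .(κ ⊗ I) X D M N .(X ⊗ D) .(D ⊗ M) .(inv (nat 4 ⊗ √2) ⊗ I) .(α ⊗ (D ⊗ (X ⊗ X)))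
    .(α ⊗ (X ⊗ X)) .(α ⊗ (M ⊗ M)) refl refl refl refl refl refl refl = solve (I ∷ X ∷ D ∷ M ∷ N ∷ []) ℚ√2-ring

  norm[4√2]≢0 : norm (nat 4 ⊗ √2) ≢ 0ℚ
  norm[4√2]≢0 ()

  α^[i+j+1] : ∀ I J d → J +n d ≡ I → α ^ (I +n J +n 1) ≡ α ⊗ (α ^ d ⊗ (α ^ J ⊗ α ^ J))
  α^[i+j+1] I J d e = trans (^-+ α (I +n J) 1) (trans (cong (_⊗ (α ^ 1)) (trans (^-+ α I J)
     (cong (_⊗ (α ^ J)) (trans (cong (α ^_) (sym e)) (^-+ α J d))))) (regroup (α ^ J) (α ^ d)))
    where
    regroup : ∀ X D → ((X ⊗ D) ⊗ X) ⊗ (α ⊗ one) ≡ α ⊗ (D ⊗ (X ⊗ X))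
    regroup X D = solve (X ∷ D ∷ []) ℚ√2-ring

  α^[2n-2i+1] : ∀ n I → α ^ (2 *n n ∸ 2 *n I +n 1) ≡ α ⊗ (α ^ (n ∸ I) ⊗ α ^ (n ∸ I))
  α^[2n-2i+1] n I = trans (cong (λ z → α ^ (z +n 1)) (sym (ℕP.*-distribˡ-∸ 2 n I))) (α^odd (n ∸ I))

  module PQResistances (n : ℕ) (1≤n : 1 ≤ n) (i j : Fin (suc n)) (j≤i : toℕ j ≤ toℕ i) where
    I J d mI mJ : ℕ
    I = toℕ i
    J = toℕ j
    d = I ∸ J
    mI = n ∸ I
    mJ = n ∸ J
    J+d≡I : J +n d ≡ I
    J+d≡I = ℕP.m+[n∸m]≡n j≤i
    module Greenᵢ = GreenSolution n 1≤n i
    module Greenⱼ = GreenSolution n 1≤n j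
    mJ≡d+mI : mJ ≡ d +n mI
    mJ≡d+mI = trans (cong (_∸ J) (sym (trans (sym (ℕP.+-assoc J d mI)) (trans (cong (_+n mI) J+d≡I) Greenᵢ.K+m≡n))))
                    (ℕP.m+n∸m≡n J (d +n mI))
    J+d≤n : J +n d ≤ n
    J+d≤n = subst (_≤ n) (sym J+d≡I) (subst (I ≤_) Greenᵢ.K+m≡n (ℕP.m≤m+n I mI))
    ramp : V n → ℚ
    ramp = rampPotential n J d

    greenᵢ-at-i : Greenᵢ.greenRow I ≡ scale n ⊗ α ^ suc 0 ⊗ endCorrection (α ^ I) ⊗ endCorrection (α ^ mI)
    greenᵢ-at-i = trans (green-left n I mI I ℕP.≤-refl) (greenLeft-form n I mI I 0 (ℕP.+-identityʳ I))
    greenᵢ-at-j : Greenᵢ.greenRow J ≡ scale n ⊗ α ^ suc d ⊗ endCorrection (α ^ J) ⊗ endCorrection (α ^ mI)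
    greenᵢ-at-j = trans (green-left n I mI J j≤i) (greenLeft-form n I mI J d J+d≡I)
    greenⱼ-at-i : Greenⱼ.greenRow I ≡ scale n ⊗ α ^ suc d ⊗ endCorrection (α ^ J) ⊗ endCorrection (α ^ mI)
    greenⱼ-at-i = trans (green-right n J mJ I Greenⱼ.K+m≡n j≤i) (greenRight-form n J I d mI J+d≡I Greenᵢ.K+m≡n)
    greenⱼ-at-j : Greenⱼ.greenRow J ≡ scale n ⊗ α ^ suc 0 ⊗ endCorrection (α ^ J) ⊗ endCorrection (α ^ mJ)
    greenⱼ-at-j = trans (green-left n J mJ J ℕP.≤-refl) (greenLeft-form n J mJ J 0 (ℕP.+-identityʳ J))

    α^I : α ^ I ≡ α ^ J ⊗ α ^ d
    α^I = trans (cong (α ^_) (sym J+d≡I)) (^-+ α J d)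
    α^mJ : α ^ mJ ≡ α ^ d ⊗ α ^ mI
    α^mJ = trans (cong (α ^_) mJ≡d+mI) (^-+ α d mI)
    inv[4√2⊗Ω] : inv (nat 4 ⊗ √2 ⊗ (one ⊖ α ^ (2 *n n +n 2))) ≡ inv (nat 4 ⊗ √2) ⊗ Ω⁻¹ n
    inv[4√2⊗Ω] = inv-⊗ (nat 4 ⊗ √2) (Ω n) norm[4√2]≢0 (norm[Ω]≢0 n)

    ramp-p-p : ramp (p i) - ramp (p j) ≡ natℚ d + natℚ d
    ramp-p-p = trans (cong₂ _-_ (trans (rampPotential-p n J d i) (rampRow-high J d I (ℕP.≤-reflexive J+d≡I)))
                                (trans (rampPotential-p n J d j) (rampRow-low J d J ℕP.≤-refl)))
                     (ℚP.+-identityʳ _)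
    ramp-q-p : ramp (q i) - ramp (p j) ≡ natℚ d + natℚ d
    ramp-q-p = trans (cong₂ _-_ (trans (rampPotential-q n J d i) (rampRow-high J d I (ℕP.≤-reflexive J+d≡I)))
                                (trans (rampPotential-p n J d j) (rampRow-low J d J ℕP.≤-refl)))
                     (ℚP.+-identityʳ _)

    laplacian-ramp : ∀ w → laplacian n ramp w ≡ δ (p i) w + δ (q i) w - (δ (p j) w + δ (q j) w)
    laplacian-ramp w = trans (laplacian-rampPotential n J d J+d≤n w)
      (cong₂ _-_ (trans (cong (λ z → rungSource n z w) J+d≡I) (rungSource≡δ n i w)) (rungSource≡δ n j w))

    -- Half the ramp carries the symmetric part of the source, the two Green solutions the antisymmetric part.
    potential-pp : V n → ℚ
    potential-pp = combination₃ ½ ½ (- ½) ramp Greenᵢ.realPart Greenⱼ.realPart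

    potential-pp-isPotential : IsPotential n (p i) (p j) potential-pp
    potential-pp-isPotential w = trans (laplacian-linear₃ n ½ ½ (- ½) ramp Greenᵢ.realPart Greenⱼ.realPart w)
      (trans (cong₃ (λ a b c → ½ * a + (½ * b + (- ½) * c))
                    (laplacian-ramp w) (Greenᵢ.realPart-isPotential w) (Greenⱼ.realPart-isPotential w))
             (sources (δ (p i) w) (δ (q i) w) (δ (p j) w) (δ (q j) w)))
      where
      sources : ∀ a b c d → ½ * (a + b - (c + d)) + (½ * (a - b) + (- ½) * (c - d)) ≡ a - c
      sources a b c d = solve (a ∷ b ∷ c ∷ d ∷ []) ℚ-ring

    potential-pp-value : embed (potential-pp (p i) - potential-pp (p j)) ≡
      nat (toℕ i ∸ toℕ j)
            ⊕ ((one ⊖ α ^ (toℕ i ∸ toℕ j))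
                ⊘ (nat 4 ⊗ √2 ⊗ (one ⊖ α ^ (2 *n n +n 2))))
              ⊗ (nat 2 ⊖ α ^ (toℕ i +n toℕ j +n 1) ⊕ α ^ (2 *n toℕ j +n 1)
                  ⊕ α ^ (2 *n n ∸ 2 *n toℕ i +n 1)
                    ⊗ (one ⊖ α ^ (toℕ i ∸ toℕ j) ⊖ nat 2 ⊗ α ^ (toℕ i +n toℕ j +n 1)))
    potential-pp-value =
      trans (embed-combination₃-difference ½ ½ (- ½) ramp Greenᵢ.realPart Greenⱼ.realPart (p i) (p j))
      (trans (cong₃ (λ s a b → embed ½ ⊗ s ⊕ (embed ½ ⊗ a ⊕ embed (- ½) ⊗ b))
                    (trans (cong embed ramp-p-p) (cong₂ _⊕_ (natℚ≡nat d) (natℚ≡nat d)))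
                    (Greenᵢ.realPart-difference (p i) (p j)) (Greenⱼ.realPart-difference (p i) (p j)))
      (trans (cong₄ (λ a b c d′ → embed ½ ⊗ (nat d ⊕ nat d) ⊕ (embed ½ ⊗ (a ⊖ b) ⊕ embed (- ½) ⊗ (c ⊖ d′)))
                    greenᵢ-at-i greenᵢ-at-j greenⱼ-at-i greenⱼ-at-j)
       (pp-value-identity (Ω⁻¹ n) (scale n) (α ^ J) (α ^ d) (α ^ mI) (nat d) (α ^ I) (α ^ mJ) _ _ _ _
         (scale-def n) α^I α^mJ inv[4√2⊗Ω] (α^[i+j+1] I J d J+d≡I) (α^odd J) (α^[2n-2i+1] n I))))

    potential-qp : V n → ℚ
    potential-qp = combination₃ ½ (- ½) (- ½) ramp Greenᵢ.realPart Greenⱼ.realPart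

    potential-qp-isPotential : IsPotential n (q i) (p j) potential-qp
    potential-qp-isPotential w = trans (laplacian-linear₃ n ½ (- ½) (- ½) ramp Greenᵢ.realPart Greenⱼ.realPart w)
      (trans (cong₃ (λ a b c → ½ * a + ((- ½) * b + (- ½) * c))
                    (laplacian-ramp w) (Greenᵢ.realPart-isPotential w) (Greenⱼ.realPart-isPotential w))
             (sources (δ (p i) w) (δ (q i) w) (δ (p j) w) (δ (q j) w)))
      where
      sources : ∀ a b c d → ½ * (a + b - (c + d)) + ((- ½) * (a - b) + (- ½) * (c - d)) ≡ b - c
      sources a b c d = solve (a ∷ b ∷ c ∷ d ∷ []) ℚ-ring

    potential-qp-value : embed (potential-qp (q i) - potential-qp (p j)) ≡
      nat (toℕ i ∸ toℕ j)
            ⊕ ((one ⊕ α ^ (toℕ i ∸ toℕ j))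
                ⊘ (nat 4 ⊗ √2 ⊗ (one ⊖ α ^ (2 *n n +n 2))))
              ⊗ (nat 2 ⊕ α ^ (toℕ i +n toℕ j +n 1) ⊕ α ^ (2 *n toℕ j +n 1)
                  ⊕ α ^ (2 *n n ∸ 2 *n toℕ i +n 1)
                    ⊗ (one ⊕ α ^ (toℕ i ∸ toℕ j) ⊕ nat 2 ⊗ α ^ (toℕ i +n toℕ j +n 1)))
    potential-qp-value =
      trans (embed-combination₃-difference ½ (- ½) (- ½) ramp Greenᵢ.realPart Greenⱼ.realPart (q i) (p j))
      (trans (cong₃ (λ s a b → embed ½ ⊗ s ⊕ (embed (- ½) ⊗ a ⊕ embed (- ½) ⊗ b))
                    (trans (cong embed ramp-q-p) (cong₂ _⊕_ (natℚ≡nat d) (natℚ≡nat d)))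
                    (Greenᵢ.realPart-difference (q i) (p j)) (Greenⱼ.realPart-difference (q i) (p j)))
      (trans (cong₄ (λ a b c d′ → embed ½ ⊗ (nat d ⊕ nat d) ⊕ (embed (- ½) ⊗ (⊖1 a ⊖ b) ⊕ embed (- ½) ⊗ (⊖1 c ⊖ d′)))
                    greenᵢ-at-i greenᵢ-at-j greenⱼ-at-i greenⱼ-at-j)
       (qp-value-identity (Ω⁻¹ n) (scale n) (α ^ J) (α ^ d) (α ^ mI) (nat d) (α ^ I) (α ^ mJ) _ _ _ _
         (scale-def n) α^I α^mJ inv[4√2⊗Ω] (α^[i+j+1] I J d J+d≡I) (α^odd J) (α^[2n-2i+1] n I))))

module ResistanceAcrossHexagon where

  open import Defs
  open SqrtTwo
  open Alpha
  open Laplacian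
  open Resistance
  open Antisymmetric
  open import Data.Nat using (ℕ; suc; _∸_; _≤_; _<_; _≡ᵇ_) renaming (_+_ to _+n_; _*_ to _*n_)
  import Data.Nat.Properties as ℕP
  open import Data.Fin using (Fin; toℕ; inject₁) renaming (suc to fs)
  import Data.Fin as Fin
  import Data.Fin.Properties as FinP
  open import Data.Rational using (ℚ; 0ℚ; 1ℚ; ½; _+_; _-_; _*_; -_)
  open import Data.Bool using (true; false; if_then_else_)
  open import Data.List using (_∷_; [])
  open import Relation.Nullary using (does)
  open import Relation.Binary.PropositionalEquality
  open import Tactic.RingSolver using (solve)

  module Dipole (n : ℕ) (i : Fin n) where
    i′ = toℕ i
    dipoleU dipoleV : ℕ → ℚ
    dipoleU j = if j ≡ᵇ i′ then 1ℚ else 0ℚ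
    dipoleV j = if j ≡ᵇ i′ then - 1ℚ else 0ℚ
    dipolePotential : V n → ℚ
    dipolePotential = fromSequences n (λ _ → 0ℚ) (λ _ → 0ℚ) dipoleU dipoleV
    i<n : i′ < n
    i<n = FinP.toℕ<n i

    0-indicator : ∀ b → 0ℚ - (if b then 1ℚ else 0ℚ) ≡ (if b then - 1ℚ else 0ℚ)
    0-indicator true = refl
    0-indicator false = refl
    0-negIndicator : ∀ b → 0ℚ - (if b then - 1ℚ else 0ℚ) ≡ (if b then 1ℚ else 0ℚ)
    0-negIndicator true = refl
    0-negIndicator false = refl

    dipoleSource : V n → ℚ
    dipoleSource = fromSequences n (λ k → - (indicator (k ≡ᵇ i′) + indicator (k ≡ᵇ suc i′))) (λ k → indicator (k ≡ᵇ i′) + indicator (k ≡ᵇ suc i′))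
                (λ k → indicator (k ≡ᵇ i′) + indicator (k ≡ᵇ i′)) (λ k → - (indicator (k ≡ᵇ i′) + indicator (k ≡ᵇ i′)))

    balance-p : ∀ b c → (0ℚ - 0ℚ) + ((if b then - 1ℚ else 0ℚ) + ((if c then - 1ℚ else 0ℚ) + 0ℚ)) ≡ - (indicator b + indicator c)
    balance-p true true = refl
    balance-p true false = refl
    balance-p false true = refl
    balance-p false false = refl
    balance-q : ∀ b c → (0ℚ - 0ℚ) + (0ℚ + (0ℚ + ((if b then 1ℚ else 0ℚ) + (if c then 1ℚ else 0ℚ)))) ≡ indicator b + indicator c
    balance-q true true = refl
    balance-q true false = refl
    balance-q false true = refl
    balance-q false false = refl
    balance-u : ∀ b → 0ℚ + (((if b then 1ℚ else 0ℚ) - 0ℚ) + (((if b then 1ℚ else 0ℚ) - 0ℚ) + (0ℚ + 0ℚ))) ≡ indicator b + indicator b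
    balance-u true = refl
    balance-u false = refl
    balance-v : ∀ b → 0ℚ + (0ℚ + (0ℚ + (((if b then - 1ℚ else 0ℚ) - 0ℚ) + ((if b then - 1ℚ else 0ℚ) - 0ℚ)))) ≡ - (indicator b + indicator b)
    balance-v true = refl
    balance-v false = refl

    laplacian-dipolePotential : ∀ w → laplacian n dipolePotential w ≡ dipoleSource w
    laplacian-dipolePotential (p k) = trans (laplacian-p n _ _ dipoleU dipoleV k)
       (trans (cong₂ (λ a b → (0ℚ - 0ℚ) + (a + (b + 0ℚ)))
          (trans (rightEdge-cong 0ℚ n (toℕ k) _ _ (λ j → 0-indicator (j ≡ᵇ i′))) (rightEdge-indicator (- 1ℚ) n (toℕ k) i′ i<n))
          (trans (leftEdge-cong 0ℚ (toℕ k) _ _ (λ j → 0-indicator (j ≡ᵇ i′))) (leftEdge-indicator (- 1ℚ) (toℕ k) i′)))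
        (balance-p (toℕ k ≡ᵇ i′) (toℕ k ≡ᵇ suc i′)))
    laplacian-dipolePotential (q k) = trans (laplacian-q n _ _ dipoleU dipoleV k)
       (trans (cong₂ (λ a b → (0ℚ - 0ℚ) + (0ℚ + (0ℚ + (a + b))))
          (trans (rightEdge-cong 0ℚ n (toℕ k) _ _ (λ j → 0-negIndicator (j ≡ᵇ i′))) (rightEdge-indicator 1ℚ n (toℕ k) i′ i<n))
          (trans (leftEdge-cong 0ℚ (toℕ k) _ _ (λ j → 0-negIndicator (j ≡ᵇ i′))) (leftEdge-indicator 1ℚ (toℕ k) i′)))
        (balance-q (toℕ k ≡ᵇ i′) (toℕ k ≡ᵇ suc i′)))
    laplacian-dipolePotential (u k) = trans (laplacian-u n _ _ dipoleU dipoleV k) (balance-u (toℕ k ≡ᵇ i′))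
    laplacian-dipolePotential (v k) = trans (laplacian-v n _ _ dipoleU dipoleV k) (balance-v (toℕ k ≡ᵇ i′))

  uv-value-identity : ∀ I c X M XK αM E A2i A2n → c ≡ κ ⊗ I → XK ≡ X → αM ≡ α ⊗ M →
    E ≡ (one ⊖ α ⊗ α ⊗ (((α ⊗ X) ⊗ (α ⊗ X)) ⊗ (M ⊗ M))) ⊗ I → A2i ≡ α ⊗ α ⊗ (X ⊗ X) → A2n ≡ α ⊗ α ⊗ (M ⊗ M) →
    let cf = λ x → one ⊕ α ⊗ (x ⊗ x) ; mean = λ a b → half ⊗ (a ⊕ b) in
    embed ½ ⊗ (mean (c ⊗ (α ⊗ one) ⊗ cf X ⊗ cf αM) (c ⊗ (α ⊗ (α ⊗ one)) ⊗ cf XK ⊗ cf M)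
                 ⊖ ⊖1 (mean (c ⊗ (α ⊗ one) ⊗ cf X ⊗ cf αM) (c ⊗ (α ⊗ (α ⊗ one)) ⊗ cf XK ⊗ cf M)))
    ⊕ (embed ½ ⊗ (mean (c ⊗ (α ⊗ (α ⊗ one)) ⊗ cf X ⊗ cf M) (c ⊗ (α ⊗ one) ⊗ cf (α ⊗ X) ⊗ cf M)
                    ⊖ ⊖1 (mean (c ⊗ (α ⊗ (α ⊗ one)) ⊗ cf X ⊗ cf M) (c ⊗ (α ⊗ one) ⊗ cf (α ⊗ X) ⊗ cf M)))
       ⊕ embed ½ ⊗ (embed (1ℚ - - 1ℚ) ⊗ E))
    ≡ √2 ⊗ (one ⊕ A2i) ⊗ (one ⊕ A2n) ⊗ I
  uv-value-identity I .(κ ⊗ I) X M .X .(α ⊗ M) .((one ⊖ α ⊗ α ⊗ (((α ⊗ X) ⊗ (α ⊗ X)) ⊗ (M ⊗ M))) ⊗ I)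
    .(α ⊗ α ⊗ (X ⊗ X)) .(α ⊗ α ⊗ (M ⊗ M)) refl refl refl refl refl refl = solve (I ∷ X ∷ M ∷ []) ℚ√2-ring

  module UVResistance (n : ℕ) (1≤n : 1 ≤ n) (i : Fin n) where
    I K m₀ m₁ : ℕ
    I = toℕ i
    K = toℕ (inject₁ i)
    m₀ = n ∸ K
    m₁ = n ∸ suc I
    K≡I : K ≡ I
    K≡I = FinP.toℕ-inject₁ i
    module Greenᵢ = GreenSolution n 1≤n (inject₁ i)
    module Greenᵢ₊₁ = GreenSolution n 1≤n (fs i)
    module Dip = Dipole n i

    -- The two Green solutions inject ½ at p i and p (i + 1) and extract it at q i and q (i + 1);
    -- the dipole returns that current to the rails and drives it from u i to v i.
    potential-uv : V n → ℚ
    potential-uv = combination₃ ½ ½ ½ Greenᵢ.realPart Greenᵢ₊₁.realPart Dip.dipolePotential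

    potential-uv-isPotential : IsPotential n (u i) (v i) potential-uv
    potential-uv-isPotential w = trans (laplacian-linear₃ n ½ ½ ½ Greenᵢ.realPart Greenᵢ₊₁.realPart Dip.dipolePotential w)
      (trans (cong₃ (λ a b c → ½ * a + (½ * b + ½ * c))
                    (Greenᵢ.realPart-isPotential w) (Greenᵢ₊₁.realPart-isPotential w) (Dip.laplacian-dipolePotential w))
             (sources w))
      where
      does-≟-inject₁ : ∀ k → does (k Fin.≟ inject₁ i) ≡ (toℕ k ≡ᵇ I)
      does-≟-inject₁ k = trans (does-≟≡≡ᵇ k (inject₁ i)) (cong (toℕ k ≡ᵇ_) K≡I)
      sources-p : ∀ a b → ½ * (a - 0ℚ) + (½ * (b - 0ℚ) + ½ * (- (a + b))) ≡ 0ℚ - 0ℚ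
      sources-p a b = solve (a ∷ b ∷ []) ℚ-ring
      sources-q : ∀ a b → ½ * (0ℚ - a) + (½ * (0ℚ - b) + ½ * (a + b)) ≡ 0ℚ - 0ℚ
      sources-q a b = solve (a ∷ b ∷ []) ℚ-ring
      sources-u : ∀ c → ½ * (0ℚ - 0ℚ) + (½ * (0ℚ - 0ℚ) + ½ * (c + c)) ≡ c - 0ℚ
      sources-u c = solve (c ∷ []) ℚ-ring
      sources-v : ∀ c → ½ * (0ℚ - 0ℚ) + (½ * (0ℚ - 0ℚ) + ½ * (- (c + c))) ≡ 0ℚ - c
      sources-v c = solve (c ∷ []) ℚ-ring
      sources : ∀ w → ½ * (δ (p (inject₁ i)) w - δ (q (inject₁ i)) w) + (½ * (δ (p (fs i)) w - δ (q (fs i)) w) + ½ * Dip.dipoleSource w)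
                    ≡ δ (u i) w - δ (v i) w
      sources (p k) =
        trans (cong₂ (λ a b → ½ * (indicator a - 0ℚ) + (½ * (indicator b - 0ℚ) + ½ * (- (indicator (toℕ k ≡ᵇ I) + indicator (toℕ k ≡ᵇ suc I)))))
                     (does-≟-inject₁ k) (does-≟≡≡ᵇ k (fs i)))
              (sources-p (indicator (toℕ k ≡ᵇ I)) (indicator (toℕ k ≡ᵇ suc I)))
      sources (q k) =
        trans (cong₂ (λ a b → ½ * (0ℚ - indicator a) + (½ * (0ℚ - indicator b) + ½ * (indicator (toℕ k ≡ᵇ I) + indicator (toℕ k ≡ᵇ suc I))))
                     (does-≟-inject₁ k) (does-≟≡≡ᵇ k (fs i)))
              (sources-q (indicator (toℕ k ≡ᵇ I)) (indicator (toℕ k ≡ᵇ suc I)))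
      sources (u k) = trans (sources-u (indicator (toℕ k ≡ᵇ I))) (cong (λ b → indicator b - 0ℚ) (sym (does-≟≡≡ᵇ k i)))
      sources (v k) = trans (sources-v (indicator (toℕ k ≡ᵇ I))) (cong (λ b → 0ℚ - indicator b) (sym (does-≟≡≡ᵇ k i)))

    I+1+m₁≡n : suc I +n m₁ ≡ n
    I+1+m₁≡n = Greenᵢ₊₁.K+m≡n
    n∸I≡m₁+1 : n ∸ I ≡ suc m₁
    n∸I≡m₁+1 = trans (cong (_∸ I) (sym I+1+m₁≡n)) (trans (cong (_∸ I) (sym (ℕP.+-suc I m₁))) (ℕP.m+n∸m≡n I (suc m₁)))

    greenᵢ-at-i : Greenᵢ.greenRow I ≡ scale n ⊗ α ^ suc 0 ⊗ endCorrection (α ^ I) ⊗ endCorrection (α ^ m₀)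
    greenᵢ-at-i = trans (green-left n K m₀ I (ℕP.≤-reflexive (sym K≡I))) (greenLeft-form n K m₀ I 0 (trans (ℕP.+-identityʳ I) (sym K≡I)))
    greenᵢ-at-i+1 : Greenᵢ.greenRow (suc I) ≡ scale n ⊗ α ^ suc 1 ⊗ endCorrection (α ^ K) ⊗ endCorrection (α ^ m₁)
    greenᵢ-at-i+1 = trans (green-right n K m₀ (suc I) Greenᵢ.K+m≡n (ℕP.≤-trans (ℕP.≤-reflexive K≡I) (ℕP.n≤1+n I)))
                          (greenRight-form n K (suc I) 1 m₁ (trans (ℕP.+-suc K 0) (cong suc (trans (ℕP.+-identityʳ K) K≡I))) I+1+m₁≡n)
    greenᵢ₊₁-at-i : Greenᵢ₊₁.greenRow I ≡ scale n ⊗ α ^ suc 1 ⊗ endCorrection (α ^ I) ⊗ endCorrection (α ^ m₁)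
    greenᵢ₊₁-at-i = trans (green-left n (suc I) m₁ I (ℕP.n≤1+n I))
                          (greenLeft-form n (suc I) m₁ I 1 (trans (ℕP.+-suc I 0) (cong suc (ℕP.+-identityʳ I))))
    greenᵢ₊₁-at-i+1 : Greenᵢ₊₁.greenRow (suc I) ≡ scale n ⊗ α ^ suc 0 ⊗ endCorrection (α ^ suc I) ⊗ endCorrection (α ^ m₁)
    greenᵢ₊₁-at-i+1 = trans (green-left n (suc I) m₁ (suc I) ℕP.≤-refl) (greenLeft-form n (suc I) m₁ (suc I) 0 (ℕP.+-identityʳ (suc I)))

    α^m₀ : α ^ m₀ ≡ α ⊗ α ^ m₁
    α^m₀ = cong (α ^_) (trans (cong (n ∸_) K≡I) n∸I≡m₁+1)
    one≡Ω⊗Ω⁻¹ : one ≡ (one ⊖ α ⊗ α ⊗ ((α ^ suc I ⊗ α ^ suc I) ⊗ (α ^ m₁ ⊗ α ^ m₁))) ⊗ Ω⁻¹ n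
    one≡Ω⊗Ω⁻¹ = sym (trans (cong (_⊗ Ω⁻¹ n) (sym (Ω-factor n (suc I) m₁ I+1+m₁≡n))) (Ω⊗Ω⁻¹ n))
    α^[2i+2] : α ^ (2 *n I +n 2) ≡ α ⊗ α ⊗ (α ^ I ⊗ α ^ I)
    α^[2i+2] = trans (^-+ α (2 *n I) 2) (trans (cong (_⊗ (α ^ 2)) (^-double α I)) (regroup (α ^ I)))
      where
      regroup : ∀ X → (X ⊗ X) ⊗ (α ⊗ (α ⊗ one)) ≡ α ⊗ α ⊗ (X ⊗ X)
      regroup X = solve (X ∷ []) ℚ√2-ring
    α^[2n-2i] : α ^ (2 *n n ∸ 2 *n I) ≡ α ⊗ α ⊗ (α ^ m₁ ⊗ α ^ m₁)
    α^[2n-2i] = trans (cong (α ^_) (trans (sym (ℕP.*-distribˡ-∸ 2 n I)) (cong (2 *n_) n∸I≡m₁+1)))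
                      (trans (^-double α (suc m₁)) (regroup (α ^ m₁)))
      where
      regroup : ∀ M → (α ⊗ M) ⊗ (α ⊗ M) ≡ α ⊗ α ⊗ (M ⊗ M)
      regroup M = solve (M ∷ []) ℚ√2-ring

    dipole-difference : embed (Dip.dipolePotential (u i) - Dip.dipolePotential (v i)) ≡ embed (1ℚ - - 1ℚ) ⊗ one
    dipole-difference = trans (cong (λ b → embed ((if b then 1ℚ else 0ℚ) - (if b then - 1ℚ else 0ℚ))) (≡ᵇ-refl I))
                              (sym (trans (⊗-comm (embed (1ℚ - - 1ℚ)) one) (⊗-identityˡ (embed (1ℚ - - 1ℚ)))))

    potential-uv-value : embed (potential-uv (u i) - potential-uv (v i)) ≡
       (√2 ⊗ (one ⊕ α ^ (2 *n toℕ i +n 2)) ⊗ (one ⊕ α ^ (2 *n n ∸ 2 *n toℕ i)))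
            ⊘ (one ⊖ α ^ (2 *n n +n 2))
    potential-uv-value =
      trans (embed-combination₃-difference ½ ½ ½ Greenᵢ.realPart Greenᵢ₊₁.realPart Dip.dipolePotential (u i) (v i))
      (trans (cong₃ (λ a b c → embed ½ ⊗ a ⊕ (embed ½ ⊗ b ⊕ embed ½ ⊗ c))
                    (Greenᵢ.realPart-difference (u i) (v i)) (Greenᵢ₊₁.realPart-difference (u i) (v i)) dipole-difference)
      (trans (cong₄ (λ a b c d → embed ½ ⊗ (half ⊗ (a ⊕ b) ⊖ ⊖1 (half ⊗ (a ⊕ b)))
                               ⊕ (embed ½ ⊗ (half ⊗ (c ⊕ d) ⊖ ⊖1 (half ⊗ (c ⊕ d))) ⊕ embed ½ ⊗ (embed (1ℚ - - 1ℚ) ⊗ one)))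
                    greenᵢ-at-i greenᵢ-at-i+1 greenᵢ₊₁-at-i greenᵢ₊₁-at-i+1)
       (uv-value-identity (Ω⁻¹ n) (scale n) (α ^ I) (α ^ m₁) (α ^ K) (α ^ m₀) one (α ^ (2 *n I +n 2)) (α ^ (2 *n n ∸ 2 *n I))
          (scale-def n) (cong (α ^_) K≡I) α^m₀ one≡Ω⊗Ω⁻¹ α^[2i+2] α^[2n-2i])))

open import Defs
open Resistance using (resistanceIs)
open Antisymmetric using (resistance-p-q)
open ResistanceAlongRails using (module PQResistances)
open ResistanceAcrossHexagon using (module UVResistance)
open import Data.Nat using (ℕ; _≤_; _∸_; _+_; _*_)
open import Data.Fin using (Fin; toℕ)
open import Data.Product using (_×_; _,_)

mainTheorem1 : (n : ℕ) → 1 ≤ n →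
  ((i : Fin (ℕ.suc n)) →
    ResistanceIs n (p i) (q i)
      (((one ⊕ α ^ (2 * n ∸ 2 * toℕ i + 1)) ⊗ (one ⊕ α ^ (2 * toℕ i + 1)))
        ⊘ (√2 ⊗ (one ⊖ α ^ (2 * n + 2)))))
  × ((i j : Fin (ℕ.suc n)) → toℕ j ≤ toℕ i →
    ResistanceIs n (p i) (p j)
      (nat (toℕ i ∸ toℕ j)
        ⊕ ((one ⊖ α ^ (toℕ i ∸ toℕ j))
            ⊘ (nat 4 ⊗ √2 ⊗ (one ⊖ α ^ (2 * n + 2))))
          ⊗ (nat 2 ⊖ α ^ (toℕ i + toℕ j + 1) ⊕ α ^ (2 * toℕ j + 1)
              ⊕ α ^ (2 * n ∸ 2 * toℕ i + 1)
                ⊗ (one ⊖ α ^ (toℕ i ∸ toℕ j) ⊖ nat 2 ⊗ α ^ (toℕ i + toℕ j + 1))))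
    × ResistanceIs n (q i) (p j)
      (nat (toℕ i ∸ toℕ j)
        ⊕ ((one ⊕ α ^ (toℕ i ∸ toℕ j))
            ⊘ (nat 4 ⊗ √2 ⊗ (one ⊖ α ^ (2 * n + 2))))
          ⊗ (nat 2 ⊕ α ^ (toℕ i + toℕ j + 1) ⊕ α ^ (2 * toℕ j + 1)
              ⊕ α ^ (2 * n ∸ 2 * toℕ i + 1)
                ⊗ (one ⊕ α ^ (toℕ i ∸ toℕ j) ⊕ nat 2 ⊗ α ^ (toℕ i + toℕ j + 1)))))
  × ((i : Fin n) →
    ResistanceIs n (u i) (v i)
      ((√2 ⊗ (one ⊕ α ^ (2 * toℕ i + 2)) ⊗ (one ⊕ α ^ (2 * n ∸ 2 * toℕ i)))
        ⊘ (one ⊖ α ^ (2 * n + 2))))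
mainTheorem1 n 1≤n =
  resistance-p-q n 1≤n ,
  (λ i j j≤i → let open PQResistances n 1≤n i j j≤i in
    resistanceIs potential-pp potential-pp-isPotential potential-pp-value ,
    resistanceIs potential-qp potential-qp-isPotential potential-qp-value) ,
  (λ i → let open UVResistance n 1≤n i in resistanceIs potential-uv potential-uv-isPotential potential-uv-value)
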